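{- Let $0\leq\varepsilon_c<\varepsilon_f\leq1$ and $g=\varepsilon_f-\varepsilon_c$. Let $G\colon\{0,1\}^R\to\mathcal{X}$ satisfy $G(U_R)\sim D$ with $U_R$ uniform on $\{0,1\}^R$. Fix $G$ and Boolean functions $f_1,\dots,f_k\colon\mathcal{X}\to\{0,1\}$ before the public sample is selected, and write $\mu_a:=\mathrm{wt}_D(f_a)=\mathbb{E}_{X\sim D}[f_a(X)]$ for $a\in[k]$. Let $r_1,\dots,r_m$ be independent uniform elements of $\{0,1\}^R$, where $\delta_{\rm samp}\in(0,1)$ and \[ m\geq\left\lceil\frac{8\ln(2k/\delta_{\rm samp})}{g^2}\right\rceil, \] and define $Y^{(a)}_i:=f_a(G(r_i))$ for each $a\in[k]$, $i\in[m]$. Except with probability at most $\delta_{\rm samp}$ over the one-time selection of the public sample, all $k$ strings simultaneously satisfy \[ \left|\frac{\|Y^{(a)}\|_1}{m}-\mu_a\right|\leq\frac g4 . \] Conditioned on this event, for any $a\in[k]$ and claimed value $\sigma_a$, the consistency check and exact-Hamming-weight subprotocol (see context) can be run on $Y^{(a)}$ without transmitting the sample itself. If that subprotocol is run with proximity parameter $g/4$ and has completeness and soundness errors at most $\delta_{\rm ipp}$, then the resulting execution has completeness and soundness errors at most $\delta_{\rm ipp}$, conditioned on the public sample. Unconditionally, each execution has error at most $\delta_{\rm samp}+\delta_{\rm ipp}$.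
   Context: $\|Y\|_1=\sum_iY_i$. Both parties know the public tapes $r_1,\dots,r_m$, may invoke $G$ on chosen tapes, and may query the $f_a$. Exact-Hamming-weight subprotocol with proximity parameter $g/4$: an interactive proof in which, given oracle access to $Y\in\{0,1\}^m$ and a claimed weight $W\in\{0,\dots,m\}$, the verifier accepts the honest prover with probability at least $1-(\text{completeness error})$ if $\|Y\|_1=W$, and accepts any cheating prover (unbounded and knowing $Y$) with probability at most the soundness error if $|\|Y\|_1/m-W/m|>g/4$. An execution for $(a,\sigma_a)$: the prover sends $W_a$ (the honest prover sends $W_a=\|Y^{(a)}\|_1$); the verifier performs the consistency check, i.e. rejects if $W_a\notin\{0,\dots,m\}$ or $|W_a/m-\sigma_a|>\varepsilon_c+g/2$; then the parties run the exact-Hamming-weight subprotocol on $Y^{(a)}$ with claimed weight $W_a$ and the verifier outputs its decision. Completeness error of an execution: bound on the probability of rejecting the honest prover when $|\mu_a-\sigma_a|\leq\varepsilon_c$; soundness error: bound on the probability of accepting any (unbounded, fully informed) prover when $|\mu_a-\sigma_a|>\varepsilon_f$. -}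

module Defs where

open import Algebra.Bundles using (CommutativeRing; Semiring)
open import Algebra.Structures using (IsCommutativeRing)
import Algebra.Definitions.RawMonoid as RawMonoidOps
import Algebra.Definitions.RawSemiring as RawSemiringOps
open import Data.Bool.Base using (Bool; true; false; if_then_else_)
import Data.Bool.Properties as Bool
open import Data.Fin.Base using (Fin; toℕ; fromℕ<)
import Data.Fin.Properties as Fin
open import Data.Integer.Base as ℤ using (ℤ; +_; -[1+_])
open import Data.List.Base as List using (List; []; _∷_; _∷ʳ_; cartesianProduct; cartesianProductWith)
open import Data.Maybe.Base using (Maybe; just; nothing)
open import Data.Nat.Base as ℕ using (ℕ; zero; suc; _!)
import Data.Nat.Properties as ℕ
open import Data.Product.Base using (_×_; _,_; ∃; proj₁; proj₂; map₂)
open import Data.Sum.Base as Sum using (_⊎_; inj₁; inj₂)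
open import Data.Vec.Base as Vec using (Vec; []; _∷_; lookup)
open import Level using (0ℓ)
open import Function.Bundles using (_⇔_)
open import Relation.Binary.PropositionalEquality.Core using (_≡_)
import Relation.Binary.Construct.StrictToNonStrict as StrictToNonStrict
open import Relation.Binary.Structures using (IsStrictTotalOrder)
open import Relation.Nullary.Decidable.Core using (Dec; yes; no; does)
open import Relation.Nullary.Negation.Core using (¬_)
open import Relation.Unary using (Pred; Decidable)

-- The axioms of the real numbers: a Dedekind-complete ordered field, which is
-- unique up to isomorphism.  Trichotomy (a field of IsStrictTotalOrder) and the
-- existence of all suprema are meant classically.  The inverse is a total
-- function; its value at 0# carries no information.
record RealNumbers : Set₁ where
  infix  8 -_ _⁻¹
  infixl 7 _*_ _/_
  infixl 6 _+_
  infix  4 _≈_ _<_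
  field
    Carrier            : Set
    _≈_ _<_            : Carrier → Carrier → Set
    _+_ _*_            : Carrier → Carrier → Carrier
    -_ _⁻¹             : Carrier → Carrier
    0# 1#              : Carrier
    isCommutativeRing  : IsCommutativeRing _≈_ _+_ _*_ -_ 0# 1#
    isStrictTotalOrder : IsStrictTotalOrder _≈_ _<_
    0<1                : 0# < 1#
    +-monoʳ-<          : ∀ z {x y} → x < y → z + x < z + y
    *-pos              : ∀ {x y} → 0# < x → 0# < y → 0# < x * y
    ⁻¹-cong            : ∀ {x y} → x ≈ y → x ⁻¹ ≈ y ⁻¹
    *-inverseʳ         : ∀ {x} → ¬ (x ≈ 0#) → x * x ⁻¹ ≈ 1#

  open StrictToNonStrict _≈_ _<_ public using (_≤_)

  IsUpperBound : (Carrier → Set) → Carrier → Set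
  IsUpperBound P b = ∀ x → P x → x ≤ b

  field
    supremum : ∀ (P : Carrier → Set) → ∃ P → ∃ (IsUpperBound P) →
               ∃ λ s → IsUpperBound P s × (∀ b → IsUpperBound P b → s ≤ b)

  commutativeRing : CommutativeRing 0ℓ 0ℓ
  commutativeRing = record { isCommutativeRing = isCommutativeRing }

  open CommutativeRing commutativeRing public using (_-_)
  open RawMonoidOps (CommutativeRing.+-rawMonoid commutativeRing) public
    using (sum) renaming (_×_ to _·_)
  open RawSemiringOps (Semiring.rawSemiring (CommutativeRing.semiring commutativeRing)) public using (_^_)

  _/_ : Carrier → Carrier → Carrier
  x / y = x * y ⁻¹

  fromℕ : ℕ → Carrier
  fromℕ n = n · 1#

  fromℤ : ℤ → Carrier
  fromℤ (+ n)    = fromℕ n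
  fromℤ -[1+ n ] = - fromℕ (suc n)

  _<?_ : ∀ x y → Dec (x < y)
  _<?_ = IsStrictTotalOrder._<?_ isStrictTotalOrder

  _≤?_ : ∀ x y → Dec (x ≤ y)
  _≤?_ = StrictToNonStrict.decidable′ _≈_ _<_ (IsStrictTotalOrder.compare isStrictTotalOrder)

  ∣_∣ : Carrier → Carrier
  ∣ x ∣ = if does (x <? 0#) then - x else x

  Converges : (ℕ → Carrier) → Carrier → Set
  Converges s l = ∀ ε → 0# < ε → ∃ λ N → ∀ n → N ℕ.≤ n → ∣ s n - l ∣ < ε

  -- e = exp x, by the exponential series.
  IsExp : Carrier → Carrier → Set
  IsExp x e = Converges (λ n → sum {n} (λ i → (x ^ toℕ i) / fromℕ (toℕ i !))) e

  -- l = ln y.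
  IsLn : Carrier → Carrier → Set
  IsLn y l = IsExp l y

  -- z = ⌈ x ⌉.
  IsCeiling : Carrier → ℤ → Set
  IsCeiling x z = (fromℤ z - 1# < x) × (x ≤ fromℤ z)

tuples : {A : Set} (n : ℕ) → List A → List (Vec A n)
tuples zero    xs = [] ∷ []
tuples (suc n) xs = cartesianProductWith _∷_ xs (tuples n xs)

bitstrings : (n : ℕ) → List (Vec Bool n)
bitstrings n = tuples n (false ∷ true ∷ [])

-- The possible public samples r₁, …, r_m; uniform choice from this list makes
-- the r_i independent and uniform.
samples : (R m : ℕ) → List (Vec (Vec Bool R) m)
samples R m = tuples m (bitstrings R)

‖_‖₁ : {m : ℕ} → Vec Bool m → ℕ
‖ Y ‖₁ = Vec.sum (Vec.map (λ b → if b then 1 else 0) Y)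

-- Interactive proofs.  A Program is the verifier's side once its private coins
-- are fixed; P and V are the sets of prover and verifier messages, and Q the set
-- of queries to a Boolean oracle, which are not part of the communication.
data Program (Q P V : Set) : Set where
  output  : Bool → Program Q P V
  query   : Q → (Bool → Program Q P V) → Program Q P V
  send    : V → Program Q P V → Program Q P V
  receive : (P → Program Q P V) → Program Q P V

-- All exchanged messages, in chronological order.
Transcript : Set → Set → Set
Transcript P V = List (P ⊎ V)

Strategy : Set → Set → Set
Strategy P V = Transcript P V → P

-- The verifier's decision and the transcript, when starting from transcript t.
run : {Q P V : Set} → Program Q P V → (Q → Bool) → Strategy P V →
      Transcript P V → Bool × Transcript P V
run (output b)  O s t = b , t
run (query q κ) O s t = run (κ (O q)) O s t
run (send v π)  O s t = run π O s (t ∷ʳ inj₂ v)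
run (receive κ) O s t = run (κ (s t)) O s (t ∷ʳ inj₁ (s t))

record Verifier (Q P V : Set) : Set where
  field
    coins   : ℕ
    program : Vec Bool coins → Program Q P V

-- Provers are unbounded and may be randomised.  The strategy is an arbitrary
-- function, so a prover chosen after other data may depend on them at will.
record Prover (P V : Set) : Set where
  field
    coins    : ℕ
    strategy : Vec Bool coins → Strategy P V

-- The syntax of an exact-Hamming-weight protocol on strings of length m: the
-- verifier gets the claimed weight and queries the positions of the string, the
-- honest prover gets the string and the claimed weight.
record WeightProtocol (m : ℕ) : Set₁ where
  field
    PMsg VMsg : Set
    coins     : ℕ
    program   : Fin (suc m) → Vec Bool coins → Program (Fin m) PMsg VMsg
    honest    : Vec Bool m → Fin (suc m) → Prover PMsg VMsg

  verifier : Fin (suc m) → Verifier (Fin m) PMsg VMsg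
  verifier W = record { coins = coins ; program = program W }

claim? : (m : ℕ) → ℤ → Maybe (Fin (suc m))
claim? m -[1+ _ ] = nothing
claim? m (+ n) with n ℕ.<? suc m
... | yes n≤m = just (fromℕ< n≤m)
... | no  _   = nothing

-- The protocol after an initial claim in ℤ has been sent, with each oracle
-- query q replaced by φ q.
simulate : {Q Q′ P V : Set} → (Q → Q′) → Program Q P V → Program Q′ (ℤ ⊎ P) V
simulate φ (output b)  = output b
simulate φ (query q κ) = query (φ q) (λ b → simulate φ (κ b))
simulate φ (send v π)  = send v (simulate φ π)
simulate {Q} {Q′} {P} {V} φ (receive κ) = receive step
  where
  step : ℤ ⊎ P → Program Q′ (ℤ ⊎ P) V
  step (inj₁ _) = output false
  step (inj₂ p) = simulate φ (κ p)

embed : {P V : Set} → P ⊎ V → (ℤ ⊎ P) ⊎ V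
embed = Sum.map₁ inj₂

dropClaim : {P V : Set} → Transcript (ℤ ⊎ P) V → Transcript P V
dropClaim = List.mapMaybe λ where
  (inj₁ (inj₁ _)) → nothing
  (inj₁ (inj₂ p)) → just (inj₁ p)
  (inj₂ v)        → just (inj₂ v)

-- Send the claim w, then follow s.
announce : {P V : Set} → ℤ → Strategy P V → Strategy (ℤ ⊎ P) V
announce w s []      = inj₁ w
announce w s (_ ∷ t) = inj₂ (s (dropClaim t))

‖‖₁-bound : {m : ℕ} (Y : Vec Bool m) → ‖ Y ‖₁ ℕ.≤ m
‖‖₁-bound []          = ℕ.z≤n
‖‖₁-bound (true  ∷ Y) = ℕ.s≤s (‖‖₁-bound Y)
‖‖₁-bound (false ∷ Y) = ℕ.m≤n⇒m≤1+n (‖‖₁-bound Y)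

weight : {m : ℕ} → Vec Bool m → Fin (suc m)
weight Y = fromℕ< (ℕ.s≤s (‖‖₁-bound Y))

module OverReals (ℝ : RealNumbers) where
  open RealNumbers ℝ

  average : {A : Set} → List A → (A → Carrier) → Carrier
  average xs h = List.foldr (λ x a → h x + a) 0# xs / fromℕ (List.length xs)

  -- The probability of E when an entry of the list is chosen uniformly.
  Pr : {A : Set} → List A → {E : Pred A 0ℓ} → Decidable E → Carrier
  Pr xs E? = average xs (λ x → if does (E? x) then 1# else 0#)

  -- A probability measure on all (Boolean-valued) events of X.
  record Distribution (X : Set) : Set where
    field
      prob        : (X → Bool) → Carrier
      prob-nonneg : ∀ E → 0# ≤ prob E
      prob-total  : prob (λ _ → true) ≈ 1#
      prob-union  : ∀ (E : ℕ → X → Bool) (U : X → Bool) →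
                   (∀ x i j → E i x ≡ true → E j x ≡ true → i ≡ j) →
                   (∀ x → U x ≡ true ⇔ ∃ λ i → E i x ≡ true) →
                   Converges (λ n → sum {n} (λ i → prob (E (toℕ i)))) (prob U)

  -- The expectation under D of the 0/1-valued f, that is, D(f = 1).
  wt : {X : Set} → Distribution X → (X → Bool) → Carrier
  wt D f = Distribution.prob D f

  -- G(U_R) ∼ D.
  HasLaw : {X : Set} {R : ℕ} → (Vec Bool R → X) → Distribution X → Set
  HasLaw {R = R} G D =
    ∀ E → Distribution.prob D E ≈ Pr (bitstrings R) (λ u → E (G u) Bool.≟ true)

  -- The probability that the verifier outputs b, over the private coins of
  -- both parties.
  outputProb : {Q P V : Set} → Bool → Verifier Q P V → (Q → Bool) → Prover P V → Carrier
  outputProb b v O p =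
    Pr (cartesianProduct (bitstrings (Verifier.coins v)) (bitstrings (Prover.coins p)))
       (λ (ρ , ρ′) → proj₁ (run (Verifier.program v ρ) O (Prover.strategy p ρ′) []) Bool.≟ b)

  acceptProb rejectProb : {Q P V : Set} → Verifier Q P V → (Q → Bool) → Prover P V → Carrier
  acceptProb = outputProb true
  rejectProb = outputProb false

  module _ {m : ℕ} (π : WeightProtocol m) where
    open WeightProtocol π

    CompletenessError≤ : Carrier → Set
    CompletenessError≤ δ = ∀ Y W → ‖ Y ‖₁ ≡ toℕ W →
      1# - δ ≤ acceptProb (verifier W) (lookup Y) (honest Y W)

    SoundnessError≤ : (proximity δ : Carrier) → Set
    SoundnessError≤ η δ = ∀ Y W (p : Prover PMsg VMsg) →
      η < ∣ fromℕ ‖ Y ‖₁ / fromℕ m - fromℕ (toℕ W) / fromℕ m ∣ →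
      acceptProb (verifier W) (lookup Y) p ≤ δ

  module Setting
    (εc εf : Carrier) {X : Set} {k : ℕ} (f : Fin k → X → Bool)
    {R : ℕ} (G : Vec Bool R → X) (D : Distribution X) (m : ℕ) where

    g : Carrier
    g = εf - εc

    Sample : Set
    Sample = Vec (Vec Bool R) m

    μ : Fin k → Carrier
    μ a = wt D (f a)

    Y[_] : Fin k → Sample → Vec Bool m
    Y[ a ] r = Vec.map (λ u → f a (G u)) r

    Good : Sample → Set
    Good r = ∀ a → ∣ fromℕ ‖ Y[ a ] r ‖₁ / fromℕ m - μ a ∣ ≤ g / fromℕ 4

    good? : Decidable Good
    good? r = Fin.all? (λ a → _ ≤? _)

    Consistent : Carrier → Fin (suc m) → Set
    Consistent σ W = ∣ fromℕ (toℕ W) / fromℕ m - σ ∣ ≤ εc + g / fromℕ 2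

    consistent? : ∀ σ W → Dec (Consistent σ W)
    consistent? σ W = _ ≤? _

    -- The oracle available to the parties: queries to the f_a.
    oracle : Fin k × X → Bool
    oracle (a , x) = f a x

    module Execution (π : WeightProtocol m) (r : Sample) (a : Fin k) (σ : Carrier) where
      open WeightProtocol π

      -- Position i of Y⁽ᵃ⁾ is read by computing G(r_i) and querying f_a there.
      position : Fin m → Fin k × X
      position i = a , G (lookup r i)

      afterClaim : Vec Bool coins → Maybe (Fin (suc m)) → Program (Fin k × X) (ℤ ⊎ PMsg) VMsg
      afterClaim ρ nothing  = output false
      afterClaim ρ (just W) =
        if does (consistent? σ W) then simulate position (program W ρ) else output false

      start : Vec Bool coins → ℤ ⊎ PMsg → Program (Fin k × X) (ℤ ⊎ PMsg) VMsg
      start ρ (inj₁ w) = afterClaim ρ (claim? m w)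
      start ρ (inj₂ _) = output false

      execVerifier : Verifier (Fin k × X) (ℤ ⊎ PMsg) VMsg
      execVerifier = record { coins = coins ; program = λ ρ → receive (start ρ) }

      ExecProver : Set
      ExecProver = Prover (ℤ ⊎ PMsg) VMsg

      honestExec : ExecProver
      honestExec = record
        { coins    = Prover.coins p
        ; strategy = λ ρ′ → announce (+ ‖ Y[ a ] r ‖₁) (Prover.strategy p ρ′)
        }
        where
        p : Prover PMsg VMsg
        p = honest (Y[ a ] r) (weight (Y[ a ] r))

      -- After a claim that passes the consistency check, the parties run π on
      -- Y⁽ᵃ⁾; the messages are the claim and those of π, so no r_i is sent.
      RunsOnSample : Set
      RunsOnSample = ∀ (W : Fin (suc m)) (ρ : Vec Bool coins) (s : Strategy PMsg VMsg) →
        Consistent σ W →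
        run (Verifier.program execVerifier ρ) oracle (announce (+ toℕ W) s) []
        ≡ map₂ (λ t → inj₁ (inj₁ (+ toℕ W)) ∷ List.map embed t)
               (run (program W ρ) (lookup (Y[ a ] r)) s [])

      rejectHonestProb : Carrier
      rejectHonestProb = rejectProb execVerifier oracle honestExec

      acceptProverProb : ExecProver → Carrier
      acceptProverProb p = acceptProb execVerifier oracle p

{-# OPTIONS --safe #-}

-- The protocol part is a triangle inequality: μ = E f and the claim W/m are
-- compared through the weight of the sample, which is within g/4 of μ.  A prover
-- of the execution yields, for each outcome of its coins, a prover of the
-- subprotocol for the weight that it announces.
--
-- The sampling part is Hoeffding's inequality with the sharp constant 2 m t², for
-- t = g/4.  As exp l is given only as the limit of the exponential series, the
-- argument uses natural powers of z = 1 + 1/Q instead of real exponentials.  The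
-- probability p = c/M of a 1 is rational, with M the number of bitstrings, so
-- all exponents in the Chernoff bound are integers once t is replaced by D/(M m),
-- with D the least integer beyond M m t.  The moment generating function
-- B j = 1 − p + p zʲ satisfies B (j+1) B (j−1) ≤ κ (B j)² with κ = (z + 1/z + 2)/4,
-- while B (−1) is bounded below by the weighted AM-GM inequality; hence
-- B J ≤ z^(pJ) κ^(J(J+1)/2), where κ^(4Q) ≤ z.  Choosing J ≈ 4 Q D/(M m) bounds the
-- tail by a power of 1/z that is at most 1 / exp l as soon as Q is large.
--
-- That l is positive, so that m is, follows from exp l = 2k/δ > 1: for x ≥ 0 the
-- Bonferroni inequalities for (1 − x/N)ᴺ show exp (−x) ≤ 1 as N → ∞.
--
-- Archimedean witnesses are available only up to double negation, which
-- suffices because ≤ is decidable.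

module Submission where

open import Defs
open import Algebra.Bundles using (CommutativeRing)
import Algebra.Properties.CommutativeSemiring.Exp as Exp
import Algebra.Properties.Ring as RingProperties
import Algebra.Properties.Semiring.Mult as Mult
import Algebra.Solver.Ring as RingSolver
import Algebra.Solver.Ring.AlmostCommutativeRing as ACR
open import Data.Bool.Base using (Bool; true; false; if_then_else_; not)
import Data.Bool.Properties as Bool
open import Data.Fin.Base using (Fin; zero; suc; toℕ)
import Data.Fin.Properties as Fin
open import Data.Integer.Base as ℤ using (ℤ; +_; -[1+_])
import Data.Integer.Properties as ℤ
open import Data.List.Base as List using (List; []; _∷_; _∷ʳ_; _++_; cartesianProduct; cartesianProductWith; length)
import Data.List.Properties as List
open import Data.Maybe.Base using (Maybe; just; nothing)
open import Data.Nat.Base as ℕ using (ℕ; zero; suc; _!)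
import Data.Nat.Properties as ℕ
import Data.Nat.Solver as ℕSolver
open import Data.Product.Base using (_×_; _,_; ∃; proj₁; proj₂; map₂)
open import Data.Sum.Base as Sum using (_⊎_; inj₁; inj₂)
open import Data.Vec.Base as Vec using (Vec; []; _∷_; lookup)
import Data.Vec.Properties as Vec
open import Function.Base using (_∘_)
open import Relation.Binary.Bundles using (StrictPartialOrder)
import Relation.Binary.Construct.StrictToNonStrict as StrictToNonStrict
open import Relation.Binary.Definitions using (tri<; tri≈; tri>)
open import Relation.Binary.PropositionalEquality.Core as ≡ using (_≡_)
import Relation.Binary.Reasoning.StrictPartialOrder as StrictPartialOrderReasoning
open import Relation.Binary.Structures using (IsStrictTotalOrder)
open import Relation.Nullary.Decidable using (dec-true)
open import Relation.Nullary.Decidable.Core using (Dec; yes; no; does; decidable-stable; ¬?)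
open import Relation.Nullary.Negation.Core using (¬_; contradiction)
open import Relation.Unary using (Decidable)

-- Arithmetic and order of the reals.

module Reals (ℝ : RealNumbers) where
  open RealNumbers ℝ public
  open CommutativeRing commutativeRing public
    using ( ring; semiring; commutativeSemiring; refl; sym; trans; reflexive
          ; +-cong; +-congˡ; +-congʳ; *-cong; *-congˡ; *-congʳ; -‿cong
          ; +-identityˡ; +-identityʳ; *-identityˡ; *-identityʳ; zeroˡ; zeroʳ
          ; +-assoc; *-assoc; +-comm; *-comm; distribˡ; distribʳ; -‿inverseʳ; isEquivalence)
  open RingProperties ring public using (-0#≈0#; -‿distribˡ-*; -‿distribʳ-*; -‿involutive; -‿+-comm)
  open Exp commutativeSemiring public using (^-congˡ; ^-homo-*; ^-assocʳ; ^-distrib-*)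
  open Mult semiring using (×-homo-+; ×1-homo-*)

  private
    module O = IsStrictTotalOrder isStrictTotalOrder
    module N = StrictToNonStrict _≈_ _<_

  open O public using (compare)
    renaming (trans to <-trans; irrefl to <-irrefl; <-respʳ-≈ to <-respʳ; <-respˡ-≈ to <-respˡ)

  strictPartialOrder : StrictPartialOrder _ _ _
  strictPartialOrder = record { isStrictPartialOrder = O.isStrictPartialOrder }

  module ≤-Reasoning = StrictPartialOrderReasoning strictPartialOrder

  ≤-refl : ∀ {x} → x ≤ x
  ≤-refl = inj₂ refl

  ≤-trans : ∀ {x y z} → x ≤ y → y ≤ z → x ≤ z
  ≤-trans = N.trans isEquivalence O.<-resp-≈ <-trans

  <-≤-trans : ∀ {x y z} → x < y → y ≤ z → x < z
  <-≤-trans = N.<-≤-trans <-trans <-respʳ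

  ≤-<-trans : ∀ {x y z} → x ≤ y → y < z → x < z
  ≤-<-trans = N.≤-<-trans sym <-trans <-respˡ

  ≤-antisym : ∀ {x y} → x ≤ y → y ≤ x → x ≈ y
  ≤-antisym = N.antisym isEquivalence <-trans <-irrefl

  ≤-total : ∀ x y → x ≤ y ⊎ y ≤ x
  ≤-total = N.total compare

  ≤⇒≯ : ∀ {x y} → x ≤ y → ¬ (y < x)
  ≤⇒≯ x≤y y<x = <-irrefl refl (≤-<-trans x≤y y<x)

  ≰⇒> : ∀ {x y} → ¬ (x ≤ y) → y < x
  ≰⇒> {x} {y} x≰y with compare x y
  ... | tri< x<y _ _ = contradiction (inj₁ x<y) x≰y
  ... | tri≈ _ x≈y _ = contradiction (inj₂ x≈y) x≰y
  ... | tri> _ _ y<x = y<x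

  ≮⇒≥ : ∀ {x y} → ¬ (x < y) → y ≤ x
  ≮⇒≥ {x} {y} x≮y with ≤-total x y
  ... | inj₁ (inj₁ x<y) = contradiction x<y x≮y
  ... | inj₁ (inj₂ x≈y) = inj₂ (sym x≈y)
  ... | inj₂ y≤x = y≤x

  ≤-stable : ∀ {x y} → ¬ ¬ (x ≤ y) → x ≤ y
  ≤-stable {x} {y} = decidable-stable (x ≤? y)

  fromℕ-+ : ∀ m n → fromℕ (m ℕ.+ n) ≈ fromℕ m + fromℕ n
  fromℕ-+ m n = ×-homo-+ 1# m n

  fromℕ-* : ∀ m n → fromℕ (m ℕ.* n) ≈ fromℕ m * fromℕ n
  fromℕ-* = ×1-homo-*

  fromℕ-1 : fromℕ 1 ≈ 1#
  fromℕ-1 = +-identityʳ 1#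

  private
    open ≤-Reasoning

    fromℤ-neg : ∀ i → fromℤ (ℤ.- i) ≈ - fromℤ i
    fromℤ-neg (+ zero)  = sym -0#≈0#
    fromℤ-neg (+ suc n) = refl
    fromℤ-neg -[1+ n ]  = sym (-‿involutive _)

    cancel : ∀ a b c → (a + b) - (a + c) ≈ b - c
    cancel a b c = begin-equality
      (a + b) - (a + c)         ≈⟨ +-congˡ (sym (-‿+-comm a c)) ⟩
      (a + b) + (- a + - c)     ≈⟨ +-congʳ (+-comm a b) ⟩
      (b + a) + (- a + - c)     ≈⟨ +-assoc b a _ ⟩
      b + (a + (- a + - c))     ≈⟨ +-congˡ (sym (+-assoc a (- a) (- c))) ⟩
      b + ((a + - a) + - c)     ≈⟨ +-congˡ (+-congʳ (-‿inverseʳ a)) ⟩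
      b + (0# + - c)            ≈⟨ +-congˡ (+-identityˡ _) ⟩
      b - c                     ∎

    fromℤ-⊖ : ∀ m n → fromℤ (m ℤ.⊖ n) ≈ fromℕ m - fromℕ n
    fromℤ-⊖ m zero = sym (trans (+-congˡ -0#≈0#) (+-identityʳ _))
    fromℤ-⊖ zero (suc n) = sym (+-identityˡ _)
    fromℤ-⊖ (suc m) (suc n) = trans (reflexive (≡.cong fromℤ (ℤ.[1+m]⊖[1+n]≡m⊖n m n)))
                              (trans (fromℤ-⊖ m n) (sym (cancel 1# _ _)))

    fromℤ-+ : ∀ i j → fromℤ (i ℤ.+ j) ≈ fromℤ i + fromℤ j
    fromℤ-+ (+ m) (+ n) = fromℕ-+ m n
    fromℤ-+ (+ m) -[1+ n ] = fromℤ-⊖ m (suc n)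
    fromℤ-+ -[1+ m ] (+ n) = trans (fromℤ-⊖ n (suc m)) (+-comm _ _)
    fromℤ-+ -[1+ m ] -[1+ n ] = trans
      (-‿cong (trans (reflexive (≡.cong fromℕ (≡.cong suc (≡.sym (ℕ.+-suc m n))))) (fromℕ-+ (suc m) (suc n))))
      (sym (-‿+-comm _ _))

    fromℤ-pos* : ∀ m j → fromℤ (+ m ℤ.* j) ≈ fromℕ m * fromℤ j
    fromℤ-pos* m (+ n) = trans (reflexive (≡.cong fromℤ (≡.sym (ℤ.pos-* m n)))) (fromℕ-* m n)
    fromℤ-pos* m -[1+ n ] = begin-equality
      fromℤ (+ m ℤ.* (ℤ.- + suc n))   ≡⟨ ≡.cong fromℤ (≡.sym (ℤ.neg-distribʳ-* (+ m) (+ suc n))) ⟩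
      fromℤ (ℤ.- (+ m ℤ.* + suc n))   ≈⟨ fromℤ-neg (+ m ℤ.* + suc n) ⟩
      - fromℤ (+ m ℤ.* + suc n)       ≈⟨ -‿cong (fromℤ-pos* m (+ suc n)) ⟩
      - (fromℕ m * fromℕ (suc n))     ≈⟨ -‿distribʳ-* _ _ ⟩
      fromℕ m * - fromℕ (suc n)       ∎

    fromℤ-* : ∀ i j → fromℤ (i ℤ.* j) ≈ fromℤ i * fromℤ j
    fromℤ-* (+ m) j = fromℤ-pos* m j
    fromℤ-* -[1+ m ] j = begin-equality
      fromℤ ((ℤ.- + suc m) ℤ.* j)   ≡⟨ ≡.cong fromℤ (≡.sym (ℤ.neg-distribˡ-* (+ suc m) j)) ⟩
      fromℤ (ℤ.- (+ suc m ℤ.* j))   ≈⟨ fromℤ-neg (+ suc m ℤ.* j) ⟩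
      - fromℤ (+ suc m ℤ.* j)       ≈⟨ -‿cong (fromℤ-pos* (suc m) j) ⟩
      - (fromℕ (suc m) * fromℤ j)   ≈⟨ -‿distribˡ-* _ _ ⟩
      - fromℕ (suc m) * fromℤ j     ∎

    -- Agrees with fromℤ, except that 1 is sent to 1# itself rather than 1# + 0#.
    ⟦_⟧ℤ : ℤ → Carrier
    ⟦ + 1 ⟧ℤ = 1#
    ⟦ i ⟧ℤ = fromℤ i

    ⟦⟧≈ : ∀ i → ⟦ i ⟧ℤ ≈ fromℤ i
    ⟦⟧≈ (+ 0) = refl
    ⟦⟧≈ (+ 1) = sym fromℕ-1
    ⟦⟧≈ (+ suc (suc n)) = refl
    ⟦⟧≈ -[1+ n ] = refl

    morphism : ℤ.+-*-rawRing ACR.-Raw-AlmostCommutative⟶ ACR.fromCommutativeRing commutativeRing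
    morphism = record
      { ⟦_⟧    = ⟦_⟧ℤ
      ; +-homo = λ i j → trans (⟦⟧≈ (i ℤ.+ j)) (trans (fromℤ-+ i j) (+-cong (sym (⟦⟧≈ i)) (sym (⟦⟧≈ j))))
      ; *-homo = λ i j → trans (⟦⟧≈ (i ℤ.* j)) (trans (fromℤ-* i j) (*-cong (sym (⟦⟧≈ i)) (sym (⟦⟧≈ j))))
      ; -‿homo = λ i → trans (⟦⟧≈ (ℤ.- i)) (trans (fromℤ-neg i) (-‿cong (sym (⟦⟧≈ i))))
      ; 0-homo = refl
      ; 1-homo = refl
      }

    coeff≟ : ∀ i j → Maybe (⟦ i ⟧ℤ ≈ ⟦ j ⟧ℤ)
    coeff≟ i j with i ℤ.≟ j
    ... | yes i≡j = just (reflexive (≡.cong ⟦_⟧ℤ i≡j))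
    ... | no  _   = nothing

  open RingSolver ℤ.+-*-rawRing (ACR.fromCommutativeRing commutativeRing) morphism coeff≟ public
    using (solve; _:=_; _:+_; _:*_; _:-_; :-_; con)

  x-y+y≈x : ∀ x y → x - y + y ≈ x
  x-y+y≈x = solve 2 (λ x y → x :- y :+ y := x) refl

  <⇒0<- : ∀ {x y} → x < y → 0# < y - x
  <⇒0<- {x} {y} x<y = <-respˡ (-‿inverseʳ x) (<-respʳ (+-comm (- x) y)
    (<-respˡ (+-comm (- x) x) (+-monoʳ-< (- x) x<y)))

  0<-⇒< : ∀ {x y} → 0# < y - x → x < y
  0<-⇒< {x} {y} 0<d = <-respˡ (+-identityʳ x) (<-respʳ (trans (+-comm x _) (x-y+y≈x y x)) (+-monoʳ-< x 0<d))

  ≤⇒0≤- : ∀ {x y} → x ≤ y → 0# ≤ y - x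
  ≤⇒0≤- (inj₁ x<y) = inj₁ (<⇒0<- x<y)
  ≤⇒0≤- {x} (inj₂ x≈y) = inj₂ (trans (sym (-‿inverseʳ x)) (+-congʳ x≈y))

  0≤-⇒≤ : ∀ {x y} → 0# ≤ y - x → x ≤ y
  0≤-⇒≤ (inj₁ 0<d) = inj₁ (0<-⇒< 0<d)
  0≤-⇒≤ {x} {y} (inj₂ 0≈d) = inj₂ (trans (sym (+-identityˡ x)) (trans (+-congʳ 0≈d) (x-y+y≈x y x)))

  -- The usual route to an inequality below: the ring solver identifies the difference of the two
  -- sides with a combination of quantities already known to be nonnegative.
  ≤-by : ∀ {x y d} → 0# ≤ d → y - x ≈ d → x ≤ y
  ≤-by 0≤d y-x≈d = 0≤-⇒≤ (≤-trans 0≤d (inj₂ (sym y-x≈d)))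

  <-by : ∀ {x y d} → 0# < d → y - x ≈ d → x < y
  <-by 0<d y-x≈d = 0<-⇒< (<-respʳ (sym y-x≈d) 0<d)

  0≤+ : ∀ {x y} → 0# ≤ x → 0# ≤ y → 0# ≤ x + y
  0≤+ {x} {y} (inj₁ 0<x) 0≤y =
    ≤-trans 0≤y (inj₁ (<-by 0<x (solve 2 (λ x y → x :+ y :- y := x) refl x y)))
  0≤+ {x} {y} (inj₂ 0≈x) 0≤y = ≤-trans 0≤y (inj₂ (trans (sym (+-identityˡ y)) (+-congʳ 0≈x)))

  0<+ : ∀ {x y} → 0# < x → 0# ≤ y → 0# < x + y
  0<+ {x} {y} 0<x 0≤y =
    ≤-<-trans 0≤y (<-by 0<x (solve 2 (λ x y → x :+ y :- y := x) refl x y))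

  0≤* : ∀ {x y} → 0# ≤ x → 0# ≤ y → 0# ≤ x * y
  0≤* (inj₁ 0<x) (inj₁ 0<y) = inj₁ (*-pos 0<x 0<y)
  0≤* {x} {y} (inj₂ 0≈x) _ = inj₂ (trans (sym (zeroˡ y)) (*-congʳ 0≈x))
  0≤* {x} {y} _ (inj₂ 0≈y) = inj₂ (trans (sym (zeroʳ x)) (*-congˡ 0≈y))

  0≤1 : 0# ≤ 1#
  0≤1 = inj₁ 0<1

  0≤^ : ∀ {x} n → 0# ≤ x → 0# ≤ x ^ n
  0≤^ zero    0≤x = 0≤1
  0≤^ (suc n) 0≤x = 0≤* 0≤x (0≤^ n 0≤x)

  0<^ : ∀ {x} n → 0# < x → 0# < x ^ n
  0<^ zero    0<x = 0<1
  0<^ (suc n) 0<x = *-pos 0<x (0<^ n 0<x)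

  0≤fromℕ : ∀ n → 0# ≤ fromℕ n
  0≤fromℕ zero    = ≤-refl
  0≤fromℕ (suc n) = 0≤+ 0≤1 (0≤fromℕ n)

  0<fromℕ : ∀ n → 0# < fromℕ (suc n)
  0<fromℕ n = 0<+ 0<1 (0≤fromℕ n)

  0≤-neg : ∀ {x} → x ≤ 0# → 0# ≤ - x
  0≤-neg {x} x≤0 = ≤-trans (≤⇒0≤- x≤0) (inj₂ (+-identityˡ (- x)))

  0≤x*x : ∀ x → 0# ≤ x * x
  0≤x*x x with ≤-total 0# x
  ... | inj₁ 0≤x = 0≤* 0≤x 0≤x
  ... | inj₂ x≤0 = ≤-trans (0≤* (0≤-neg x≤0) (0≤-neg x≤0))
                     (inj₂ (solve 1 (λ x → :- x :* :- x := x :* x) refl x))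

  +-mono-≤ : ∀ {w x y z} → w ≤ x → y ≤ z → w + y ≤ x + z
  +-mono-≤ {w} {x} {y} {z} w≤x y≤z = ≤-by (0≤+ (≤⇒0≤- w≤x) (≤⇒0≤- y≤z))
    (solve 4 (λ w x y z → x :+ z :- (w :+ y) := (x :- w) :+ (z :- y)) refl w x y z)

  *-monoˡ-≤ : ∀ {x y z} → 0# ≤ z → x ≤ y → z * x ≤ z * y
  *-monoˡ-≤ {x} {y} {z} 0≤z x≤y = ≤-by (0≤* 0≤z (≤⇒0≤- x≤y))
    (solve 3 (λ x y z → z :* y :- z :* x := z :* (y :- x)) refl x y z)

  *-monoʳ-≤ : ∀ {x y z} → 0# ≤ z → x ≤ y → x * z ≤ y * z
  *-monoʳ-≤ {x} {y} {z} 0≤z x≤y = ≤-by (0≤* 0≤z (≤⇒0≤- x≤y))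
    (solve 3 (λ x y z → y :* z :- x :* z := z :* (y :- x)) refl x y z)

  *-monoˡ-< : ∀ {x y z} → 0# < z → x < y → z * x < z * y
  *-monoˡ-< {x} {y} {z} 0<z x<y = <-by (*-pos 0<z (<⇒0<- x<y))
    (solve 3 (λ x y z → z :* y :- z :* x := z :* (y :- x)) refl x y z)

  *-mono-≤ : ∀ {w x y z} → 0# ≤ x → 0# ≤ y → w ≤ x → y ≤ z → w * y ≤ x * z
  *-mono-≤ 0≤x 0≤y w≤x y≤z = ≤-trans (*-monoʳ-≤ 0≤y w≤x) (*-monoˡ-≤ 0≤x y≤z)

  *-cancelˡ-≤ : ∀ {x y z} → 0# < z → z * x ≤ z * y → x ≤ y
  *-cancelˡ-≤ 0<z zx≤zy = ≮⇒≥ (λ y<x → ≤⇒≯ zx≤zy (*-monoˡ-< 0<z y<x))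

  *-cancelˡ-< : ∀ {x y z} → 0# ≤ z → z * x < z * y → x < y
  *-cancelˡ-< {x} {y} {z} 0≤z zx<zy with x <? y
  ... | yes x<y = x<y
  ... | no  x≮y = contradiction zx<zy (≤⇒≯ (*-monoˡ-≤ 0≤z (≮⇒≥ x≮y)))

  *-cancelˡ-≈ : ∀ {x y z} → 0# < z → z * x ≈ z * y → x ≈ y
  *-cancelˡ-≈ 0<z eq = ≤-antisym (*-cancelˡ-≤ 0<z (inj₂ eq)) (*-cancelˡ-≤ 0<z (inj₂ (sym eq)))

  ^-monoˡ-≤ : ∀ {x y} n → 0# ≤ x → x ≤ y → x ^ n ≤ y ^ n
  ^-monoˡ-≤ zero    0≤x x≤y = ≤-refl
  ^-monoˡ-≤ (suc n) 0≤x x≤y = *-mono-≤ (≤-trans 0≤x x≤y) (0≤^ n 0≤x) x≤y (^-monoˡ-≤ n 0≤x x≤y)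

  1≤^ : ∀ {x} n → 1# ≤ x → 1# ≤ x ^ n
  1≤^ zero    1≤x = ≤-refl
  1≤^ {x} (suc n) 1≤x = ≤-trans (inj₂ (sym (*-identityˡ 1#))) (*-mono-≤ (≤-trans 0≤1 1≤x) 0≤1 1≤x (1≤^ n 1≤x))

  ^-monoʳ-≤ : ∀ {x m n} → 1# ≤ x → m ℕ.≤ n → x ^ m ≤ x ^ n
  ^-monoʳ-≤ {x} {m} {n} 1≤x m≤n with ℕ.m≤n⇒∃[o]m+o≡n m≤n
  ... | o , ≡.refl = begin
    x ^ m            ≈⟨ *-identityʳ _ ⟨
    x ^ m * 1#       ≤⟨ *-monoˡ-≤ (0≤^ m (≤-trans 0≤1 1≤x)) (1≤^ o 1≤x) ⟩
    x ^ m * x ^ o    ≈⟨ ^-homo-* x m o ⟨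
    x ^ (m ℕ.+ o)    ∎
    where open ≤-Reasoning

  1^ : ∀ n → 1# ^ n ≈ 1#
  1^ zero    = refl
  1^ (suc n) = trans (*-identityˡ _) (1^ n)

  fromℕ-mono-≤ : ∀ {m n} → m ℕ.≤ n → fromℕ m ≤ fromℕ n
  fromℕ-mono-≤ {n = n} ℕ.z≤n = 0≤fromℕ n
  fromℕ-mono-≤ (ℕ.s≤s m≤n) = +-mono-≤ ≤-refl (fromℕ-mono-≤ m≤n)

  fromℕ-cancel-≤ : ∀ {m n} → fromℕ m ≤ fromℕ n → m ℕ.≤ n
  fromℕ-cancel-≤ {m} {n} m≤n with m ℕ.≤? n
  ... | yes p = p
  ... | no  p = contradiction (≤-trans (fromℕ-mono-≤ (ℕ.≰⇒> p)) m≤n)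
                  (λ 1+n≤n → ≤⇒≯ 1+n≤n (<-by 0<1 (solve 1 (λ x → con (+ 1) :+ x :- x := con (+ 1)) refl (fromℕ n))))

  0<⇒≉0 : ∀ {x} → 0# < x → ¬ (x ≈ 0#)
  0<⇒≉0 0<x x≈0 = <-irrefl (sym x≈0) 0<x

  *-⁻¹ : ∀ {x} → 0# < x → x * x ⁻¹ ≈ 1#
  *-⁻¹ 0<x = *-inverseʳ (0<⇒≉0 0<x)

  0<⁻¹ : ∀ {x} → 0# < x → 0# < x ⁻¹
  0<⁻¹ {x} 0<x = *-cancelˡ-< (inj₁ 0<x) (<-respˡ (sym (zeroʳ x)) (<-respʳ (sym (*-⁻¹ 0<x)) 0<1))

  *-/-cancel : ∀ {x} y → 0# < x → x * (y / x) ≈ y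
  *-/-cancel {x} y 0<x = trans (solve 3 (λ x y i → x :* (y :* i) := (x :* i) :* y) refl x y (x ⁻¹))
    (trans (*-congʳ (*-⁻¹ 0<x)) (*-identityˡ y))

  ≤-/ : ∀ {x y z} → 0# < z → z * x ≤ y → x ≤ y / z
  ≤-/ {y = y} 0<z zx≤y = *-cancelˡ-≤ 0<z (≤-trans zx≤y (inj₂ (sym (*-/-cancel y 0<z))))

  /-≤ : ∀ {x y z} → 0# < z → y ≤ z * x → y / z ≤ x
  /-≤ {y = y} 0<z y≤zx = *-cancelˡ-≤ 0<z (≤-trans (inj₂ (*-/-cancel y 0<z)) y≤zx)

  0≤/ : ∀ {x y} → 0# ≤ x → 0# < y → 0# ≤ x / y
  0≤/ 0≤x 0<y = 0≤* 0≤x (inj₁ (0<⁻¹ 0<y))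

  x≤∣x∣ : ∀ x → x ≤ ∣ x ∣
  x≤∣x∣ x with x <? 0#
  ... | yes x<0 = ≤-trans (inj₁ x<0) (0≤-neg (inj₁ x<0))
  ... | no  _   = ≤-refl

  -x≤∣x∣ : ∀ x → - x ≤ ∣ x ∣
  -x≤∣x∣ x with x <? 0#
  ... | yes _   = ≤-refl
  ... | no  x≮0 = ≤-by (0≤+ (≮⇒≥ x≮0) (≮⇒≥ x≮0)) (solve 1 (λ x → x :- (:- x) := x :+ x) refl x)

  ∣∣-elim : ∀ (P : Carrier → Set) x → P x → P (- x) → P ∣ x ∣
  ∣∣-elim P x p q with x <? 0#
  ... | yes _ = q
  ... | no  _ = p

-- Truncations of the exponential series.

module Exponential (ℝ : RealNumbers) where
  open Reals ℝ

  -- If no natural number exceeded `B`, the naturals would have a supremum s. As n + 1 ≤ s for every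
  -- n, the smaller number s - 1 would be an upper bound too.
  archimedean : ∀ B → ¬ ¬ ∃ λ n → B < fromℕ n
  archimedean B ¬n = ≤⇒≯ (proj₂ (proj₂ sup) (proj₁ sup - 1#) bound) s-1<s
    where
    IsNatural : Carrier → Set
    IsNatural x = ∃ λ n → x ≈ fromℕ n
    sup = supremum IsNatural (0# , 0 , refl)
      (B , λ x (n , x≈n) → ≤-trans (inj₂ x≈n) (≮⇒≥ (λ B<n → ¬n (n , B<n))))
    bound : IsUpperBound IsNatural (proj₁ sup - 1#)
    bound x (n , x≈n) = ≤-by (≤⇒0≤- (proj₁ (proj₂ sup) (fromℕ (suc n)) (suc n , refl)))
      (trans (+-congˡ (-‿cong x≈n))
        (solve 2 (λ s n → s :- con (+ 1) :- n := s :- (con (+ 1) :+ n)) refl (proj₁ sup) (fromℕ n)))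
    s-1<s : proj₁ sup - 1# < proj₁ sup
    s-1<s = <-by 0<1 (solve 1 (λ s → s :- (s :- con (+ 1)) := con (+ 1)) refl (proj₁ sup))

  -- Bounds at cofinally many indices suffice, which later admits the even truncations of an
  -- alternating series. If `B < L`, such a term within `L - B` of the limit would still have to
  -- exceed `B`.
  converges-≤ : ∀ {s L B} → Converges s L → (∀ N → ∃ λ n → N ℕ.≤ n × s n ≤ B) → L ≤ B
  converges-≤ {s} {L} {B} s→L s≤B = ≮⇒≥ λ B<L →
    let N , close = s→L (L - B) (<⇒0<- B<L)
        n , N≤n , sn≤B = s≤B N
        open ≤-Reasoning
    in <-irrefl refl (begin-strict
      L - B             ≤⟨ ≤-by (≤⇒0≤- sn≤B) (solve 3 (λ s L B → :- (s :- L) :- (L :- B) := B :- s) refl (s n) L B) ⟩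
      - (s n - L)       ≤⟨ -x≤∣x∣ (s n - L) ⟩
      ∣ s n - L ∣       <⟨ close n N≤n ⟩
      L - B             ∎)

  -- Convexity of the power: the tangent at `a`, evaluated at `b`, lies below the graph. In the
  -- induction, the slack for the next exponent is `b` times the previous slack plus a nonnegative
  -- multiple of (a - b)².
  tangent : ∀ n {a b} → 0# ≤ a → 0# ≤ b →
            a ^ suc n ≤ b ^ suc n + fromℕ (suc n) * (a ^ n * (a - b))
  tangent zero {a} {b} _ _ = inj₂
    (solve 2 (λ a b → a :* con (+ 1) := b :* con (+ 1) :+ (con (+ 1) :+ con (+ 0)) :* (con (+ 1) :* (a :- b))) refl a b)
  tangent (suc n) {a} {b} 0≤a 0≤b = ≤-by
    (0≤+ (0≤* 0≤b (≤⇒0≤- (tangent n 0≤a 0≤b)))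
         (0≤* (0≤* (0≤fromℕ (suc n)) (0≤^ n 0≤a)) (0≤x*x (a - b))))
    (solve 5 (λ a b A Y N →
       b :* Y :+ (con (+ 1) :+ N) :* (a :* A :* (a :- b)) :- a :* (a :* A) :=
       b :* (Y :+ N :* (A :* (a :- b)) :- a :* A) :+ N :* A :* ((a :- b) :* (a :- b)))
      refl a b (a ^ n) (b ^ suc n) (fromℕ (suc n)))

  -- Peels off the last summand, as inductions on the length of a truncation require, whereas `sum`
  -- peels off the first.
  Σ< : (ℕ → Carrier) → ℕ → Carrier
  Σ< f zero    = 0#
  Σ< f (suc n) = Σ< f n + f n

  Σ<-front : ∀ f n → Σ< f (suc n) ≈ f 0 + Σ< (λ i → f (suc i)) n
  Σ<-front f zero    = +-comm _ _
  Σ<-front f (suc n) = trans (+-congʳ (Σ<-front f n)) (+-assoc _ _ _)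

  sum≈Σ< : ∀ f n → sum {n} (λ i → f (toℕ i)) ≈ Σ< f n
  sum≈Σ< f zero    = refl
  sum≈Σ< f (suc n) = trans (+-congˡ (sum≈Σ< (λ i → f (suc i)) n)) (sym (Σ<-front f n))

  Σ<-mono : ∀ {f h} n → (∀ i → f i ≤ h i) → Σ< f n ≤ Σ< h n
  Σ<-mono zero    f≤h = ≤-refl
  Σ<-mono (suc n) f≤h = +-mono-≤ (Σ<-mono n f≤h) (f≤h n)

  0≤Σ< : ∀ {f} n → (∀ i → 0# ≤ f i) → 0# ≤ Σ< f n
  0≤Σ< zero    0≤f = ≤-refl
  0≤Σ< (suc n) 0≤f = 0≤+ (0≤Σ< n 0≤f) (0≤f n)

  expTerm : Carrier → ℕ → Carrier
  expTerm x i = x ^ i / fromℕ (i !)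

  expSum : Carrier → ℕ → Carrier
  expSum x = Σ< (expTerm x)

  0<fromℕ! : ∀ i → 0# < fromℕ (i !)
  0<fromℕ! zero    = 0<fromℕ 0
  0<fromℕ! (suc i) = <-respʳ (sym (fromℕ-* (suc i) (i !))) (*-pos (0<fromℕ i) (0<fromℕ! i))

  expTerm-! : ∀ x i → fromℕ (i !) * expTerm x i ≈ x ^ i
  expTerm-! x i = *-/-cancel (x ^ i) (0<fromℕ! i)

  expTerm-suc : ∀ x i → fromℕ (suc i) * expTerm x (suc i) ≈ x * expTerm x i
  expTerm-suc x i = *-cancelˡ-≈ (0<fromℕ! i) (begin-equality
    F * (S * e′)               ≈⟨ solve 3 (λ F S e → F :* (S :* e) := S :* F :* e) refl F S e′ ⟩
    S * F * e′                 ≈⟨ *-congʳ (fromℕ-* (suc i) (i !)) ⟨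
    fromℕ (suc i !) * e′       ≈⟨ expTerm-! x (suc i) ⟩
    x * x ^ i                  ≈⟨ *-congˡ (expTerm-! x i) ⟨
    x * (F * e)                ≈⟨ solve 3 (λ x F e → x :* (F :* e) := F :* (x :* e)) refl x F e ⟩
    F * (x * e)                ∎)
    where
    open ≤-Reasoning
    F = fromℕ (i !)
    S = fromℕ (suc i)
    e = expTerm x i
    e′ = expTerm x (suc i)

  expTerm-0 : ∀ x → expTerm x 0 ≈ 1#
  expTerm-0 x = *-cancelˡ-≈ (0<fromℕ! 0) (trans (expTerm-! x 0) (solve 0 (con (+ 1) := (con (+ 1) :+ con (+ 0)) :* con (+ 1)) refl))

  expTerm-cong : ∀ {x y} → x ≈ y → ∀ i → expTerm x i ≈ expTerm y i
  expTerm-cong x≈y i = *-congʳ (^-congˡ i x≈y)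

  0≤expTerm : ∀ {x} i → 0# ≤ x → 0# ≤ expTerm x i
  0≤expTerm i 0≤x = 0≤/ (0≤^ i 0≤x) (0<fromℕ! i)

  0≤expSum : ∀ {x} n → 0# ≤ x → 0# ≤ expSum x n
  0≤expSum n 0≤x = 0≤Σ< n (λ i → 0≤expTerm i 0≤x)

  expSum-mono : ∀ {x y} n → 0# ≤ x → x ≤ y → expSum x n ≤ expSum y n
  expSum-mono n 0≤x x≤y = Σ<-mono n (λ i → *-monoʳ-≤ (inj₁ (0<⁻¹ (0<fromℕ! i))) (^-monoˡ-≤ i 0≤x x≤y))

  expSum-cong : ∀ {x y} n → x ≈ y → expSum x n ≈ expSum y n
  expSum-cong zero    x≈y = refl
  expSum-cong (suc n) x≈y = +-cong (expSum-cong n x≈y) (expTerm-cong x≈y n)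

  -- This is `tangent` divided by (i + 1)!; the factor i + 1 from the derivative turns aⁱ / (i + 1)!
  -- into the preceding term of the series.
  expTerm-tangent : ∀ i {a b} → 0# ≤ a → 0# ≤ b →
                    expTerm a (suc i) ≤ expTerm b (suc i) + (a - b) * expTerm a i
  expTerm-tangent i {a} {b} 0≤a 0≤b = *-cancelˡ-≤ (0<fromℕ! (suc i)) (begin
    F′ * expTerm a (suc i)                       ≈⟨ expTerm-! a (suc i) ⟩
    a ^ suc i                                    ≤⟨ tangent i 0≤a 0≤b ⟩
    b ^ suc i + S * (a ^ i * (a - b))            ≈⟨ +-cong (expTerm-! b (suc i)) (*-congˡ (*-congʳ (expTerm-! a i))) ⟨
    F′ * e + S * (F * e′ * (a - b))              ≈⟨ solve 5 (λ x S F e′ d → x :+ S :* (F :* e′ :* d) := x :+ S :* F :* (d :* e′)) refl (F′ * e) S F e′ (a - b) ⟩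
    F′ * e + S * F * ((a - b) * e′)              ≈⟨ +-congˡ (*-congʳ (fromℕ-* (suc i) (i !))) ⟨
    F′ * e + F′ * ((a - b) * e′)                 ≈⟨ distribˡ F′ _ _ ⟨
    F′ * (e + (a - b) * e′)                      ∎)
    where
    open ≤-Reasoning
    F = fromℕ (i !)
    F′ = fromℕ (suc i !)
    S = fromℕ (suc i)
    e = expTerm b (suc i)
    e′ = expTerm a i

  expSum-tangent : ∀ n {a b} → 0# ≤ a → 0# ≤ b →
                   expSum a (suc n) ≤ expSum b (suc n) + (a - b) * expSum a n
  expSum-tangent zero {a} {b} _ _ = inj₂ (begin-equality
    0# + expTerm a 0                    ≈⟨ +-congˡ (trans (expTerm-0 a) (sym (expTerm-0 b))) ⟩
    0# + expTerm b 0                    ≈⟨ solve 2 (λ x y → x := x :+ y :* con (+ 0)) refl (0# + expTerm b 0) (a - b) ⟩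
    0# + expTerm b 0 + (a - b) * 0#     ∎)
    where open ≤-Reasoning
  expSum-tangent (suc n) {a} {b} 0≤a 0≤b = begin
    expSum a (suc n) + expTerm a (suc n)   ≤⟨ +-mono-≤ (expSum-tangent n 0≤a 0≤b) (expTerm-tangent n 0≤a 0≤b) ⟩
    (expSum b (suc n) + (a - b) * expSum a n) + (expTerm b (suc n) + (a - b) * expTerm a n)
      ≈⟨ solve 5 (λ s t s′ t′ d → (s :+ d :* s′) :+ (t :+ d :* t′) := s :+ t :+ d :* (s′ :+ t′)) refl
           (expSum b (suc n)) (expTerm b (suc n)) (expSum a n) (expTerm a n) (a - b) ⟩
    expSum b (suc n) + expTerm b (suc n) + (a - b) * (expSum a n + expTerm a n) ∎
    where open ≤-Reasoning

  -- A truncated form of exp (b + u) (1 - u) ≤ exp b, from the tangent at b + u. In `expSum-tangent`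
  -- the slope has one term fewer than the values; that term is nonnegative, so including it on the
  -- left only strengthens the subtraction.
  expSum-step : ∀ n {b u} → 0# ≤ b → 0# ≤ u → expSum (b + u) n * (1# - u) ≤ expSum b n
  expSum-step zero {b} {u} _ _ = inj₂ (zeroˡ (1# - u))
  expSum-step (suc n) {b} {u} 0≤b 0≤u = ≤-by
    (0≤+ (≤⇒0≤- (expSum-tangent n (0≤+ 0≤b 0≤u) 0≤b)) (0≤* 0≤u (0≤expTerm n (0≤+ 0≤b 0≤u))))
    (solve 5 (λ b u s t B → B :- (s :+ t) :* (con (+ 1) :- u) := B :+ (b :+ u :- b) :* s :- (s :+ t) :+ u :* t) refl
       b u (expSum (b + u) n) (expTerm (b + u) n) (expSum b (suc n)))

  expSum-≈0 : ∀ n {x} → x ≈ 0# → expSum x n ≤ 1#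
  expSum-≈0 zero x≈0 = 0≤1
  expSum-≈0 (suc n) {x} x≈0 = inj₂ (go n)
    where
    open ≤-Reasoning
    go : ∀ n → expSum x (suc n) ≈ 1#
    go zero = trans (+-identityˡ _) (expTerm-0 x)
    go (suc n) = trans (+-cong (go n) (*-cancelˡ-≈ (0<fromℕ n) (begin-equality
      fromℕ (suc n) * expTerm x (suc n)   ≈⟨ expTerm-suc x n ⟩
      x * expTerm x n                     ≈⟨ *-congʳ x≈0 ⟩
      0# * expTerm x n                    ≈⟨ solve 2 (λ e s → con (+ 0) :* e := s :* con (+ 0)) refl (expTerm x n) (fromℕ (suc n)) ⟩
      fromℕ (suc n) * 0#                  ∎))) (+-identityʳ 1#)

  -- exp (N u) ≤ (1 − u)⁻ᴺ, one factor at a time.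
  expSum-bound : ∀ n N {u} → 0# ≤ u → u ≤ 1# → expSum (fromℕ N * u) n * (1# - u) ^ N ≤ 1#
  expSum-bound n zero {u} _ _ = ≤-trans (inj₂ (*-identityʳ _)) (expSum-≈0 n (zeroˡ u))
  expSum-bound n (suc N) {u} 0≤u u≤1 = begin
    expSum (fromℕ (suc N) * u) n * ((1# - u) * (1# - u) ^ N)
      ≈⟨ *-congʳ (expSum-cong n (solve 2 (λ N u → (con (+ 1) :+ N) :* u := N :* u :+ u) refl (fromℕ N) u)) ⟩
    expSum (fromℕ N * u + u) n * ((1# - u) * (1# - u) ^ N)
      ≈⟨ *-assoc _ _ _ ⟨
    expSum (fromℕ N * u + u) n * (1# - u) * (1# - u) ^ N
      ≤⟨ *-monoʳ-≤ (0≤^ N (≤⇒0≤- u≤1)) (expSum-step n (0≤* (0≤fromℕ N) 0≤u) 0≤u) ⟩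
    expSum (fromℕ N * u) n * (1# - u) ^ N
      ≤⟨ expSum-bound n N 0≤u u≤1 ⟩
    1# ∎
    where open ≤-Reasoning

-- The Bonferroni inequalities and the exponential at nonpositive arguments.

module Bonferroni (ℝ : RealNumbers) where
  open Reals ℝ
  open Exponential ℝ

  -- uⁱ · (N choose i)
  binomialTerm : Carrier → ℕ → ℕ → Carrier
  binomialTerm u zero    N       = 1#
  binomialTerm u (suc i) zero    = 0#
  binomialTerm u (suc i) (suc N) = binomialTerm u (suc i) N + u * binomialTerm u i N

  sign : ℕ → Carrier
  sign i = (- 1#) ^ i

  sign-double : ∀ n → sign (n ℕ.+ n) ≈ 1#
  sign-double n = trans (^-homo-* (- 1#) n n) (square n)
    where
    square : ∀ n → sign n * sign n ≈ 1#
    square zero    = *-identityˡ 1#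
    square (suc n) = trans (solve 1 (λ s → (:- con (+ 1) :* s) :* (:- con (+ 1) :* s) := s :* s) refl (sign n)) (square n)

  sign*≤ : ∀ i {d} → 0# ≤ d → sign i * d ≤ d × - (sign i * d) ≤ d
  sign*≤ zero {d} 0≤d = inj₂ (*-identityˡ d) ,
    ≤-by (0≤+ 0≤d 0≤d) (solve 1 (λ d → d :- :- (con (+ 1) :* d) := d :+ d) refl d)
  sign*≤ (suc i) {d} 0≤d with sign*≤ i 0≤d
  ... | +≤ , -≤ =
    ≤-trans (inj₂ (solve 2 (λ s d → :- con (+ 1) :* s :* d := :- (s :* d)) refl (sign i) d)) -≤ ,
    ≤-trans (inj₂ (solve 2 (λ s d → :- (:- con (+ 1) :* s :* d) := s :* d) refl (sign i) d)) +≤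

  truncated : Carrier → ℕ → ℕ → Carrier
  truncated u r N = Σ< (λ i → sign i * binomialTerm u i N) r

  truncated-pascal : ∀ u r N → truncated u (suc r) (suc N) ≈ truncated u (suc r) N - u * truncated u r N
  truncated-pascal u zero    N = solve 2 (λ u s → con (+ 0) :+ s := con (+ 0) :+ s :- u :* con (+ 0)) refl u (1# * 1#)
  truncated-pascal u (suc r) N = trans (+-congʳ (truncated-pascal u r N))
    (solve 6 (λ H H′ u s b b′ →
       H :- u :* H′ :+ :- con (+ 1) :* s :* (b :+ u :* b′) :=
       H :+ :- con (+ 1) :* s :* b :- u :* (H′ :+ s :* b′))
      refl (truncated u (suc r) N) (truncated u r N) u (sign r) (binomialTerm u (suc r) N) (binomialTerm u r N))

  truncated-1 : ∀ u r → truncated u (suc r) 0 ≈ 1#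
  truncated-1 u zero    = trans (+-identityˡ _) (*-identityˡ 1#)
  truncated-1 u (suc r) = trans (+-cong (truncated-1 u r) (zeroʳ _)) (+-identityʳ 1#)

  -- By `truncated-pascal` the truncations obey the same recurrence as the powers, (1 - u)ᴺ⁺¹ = (1 -
  -- u)ᴺ - u (1 - u)ᴺ, hence so do the errors. The alternating sign turns the minus into a plus: the
  -- signed error at (r + 1, N + 1) is that at (r + 1, N) plus u times that at (r, N).
  bonferroni : ∀ {u} → 0# ≤ u → u ≤ 1# → ∀ N r → 0# ≤ sign r * ((1# - u) ^ N - truncated u r N)
  bonferroni {u} 0≤u u≤1 N zero = ≤-trans (0≤^ N (≤⇒0≤- u≤1))
    (inj₂ (solve 1 (λ x → x := con (+ 1) :* (x :- con (+ 0))) refl ((1# - u) ^ N)))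
  bonferroni {u} 0≤u u≤1 zero (suc r) = inj₂ (begin-equality
    0#                                        ≈⟨ solve 1 (λ s → con (+ 0) := s :* (con (+ 1) :- con (+ 1))) refl (sign (suc r)) ⟩
    sign (suc r) * (1# - 1#)                  ≈⟨ *-congˡ (+-congˡ (-‿cong (truncated-1 u r))) ⟨
    sign (suc r) * (1# - truncated u (suc r) 0) ∎)
    where open ≤-Reasoning
  bonferroni {u} 0≤u u≤1 (suc N) (suc r) = begin
    0#
      ≤⟨ 0≤+ (bonferroni 0≤u u≤1 N (suc r)) (0≤* 0≤u (bonferroni 0≤u u≤1 N r)) ⟩
    - 1# * sign r * ((1# - u) ^ N - truncated u (suc r) N) + u * (sign r * ((1# - u) ^ N - truncated u r N))
      ≈⟨ solve 5 (λ u s p H H′ → :- con (+ 1) :* s :* (p :- H) :+ u :* (s :* (p :- H′)) :=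
                    :- con (+ 1) :* s :* ((con (+ 1) :- u) :* p :- (H :- u :* H′)))
           refl u (sign r) ((1# - u) ^ N) (truncated u (suc r) N) (truncated u r N) ⟩
    - 1# * sign r * ((1# - u) * (1# - u) ^ N - (truncated u (suc r) N - u * truncated u r N))
      ≈⟨ *-congˡ (+-congˡ (-‿cong (truncated-pascal u r N))) ⟨
    - 1# * sign r * ((1# - u) * (1# - u) ^ N - truncated u (suc r) (suc N)) ∎
    where open ≤-Reasoning

  -- The absorption identity (i + 1) C(N, i + 1) = (N - i) C(N, i), scaled by uⁱ⁺¹. The subtraction
  -- is that of the field, so the case N < i is covered: both sides vanish there.
  binomialTerm-absorb : ∀ u i N → fromℕ (suc i) * binomialTerm u (suc i) N ≈
                                  (fromℕ N - fromℕ i) * (u * binomialTerm u i N)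
  binomialTerm-absorb u zero zero = solve 1
    (λ u → (con (+ 1) :+ con (+ 0)) :* con (+ 0) := (con (+ 0) :- con (+ 0)) :* (u :* con (+ 1))) refl u
  binomialTerm-absorb u (suc i) zero = solve 2
    (λ u S → (con (+ 1) :+ S) :* con (+ 0) := (con (+ 0) :- S) :* (u :* con (+ 0))) refl u (fromℕ (suc i))
  binomialTerm-absorb u zero (suc N) = begin-equality
    fromℕ 1 * (b + u * 1#)
      ≈⟨ distribˡ _ _ _ ⟩
    fromℕ 1 * b + fromℕ 1 * (u * 1#)
      ≈⟨ +-congʳ (binomialTerm-absorb u zero N) ⟩
    (fromℕ N - 0#) * (u * 1#) + (1# + 0#) * (u * 1#)
      ≈⟨ solve 2 (λ n u → (n :- con (+ 0)) :* u :+ (con (+ 1) :+ con (+ 0)) :* u := (con (+ 1) :+ n :- con (+ 0)) :* u) refl (fromℕ N) (u * 1#) ⟩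
    (fromℕ (suc N) - 0#) * (u * 1#) ∎
    where
    open ≤-Reasoning
    b = binomialTerm u 1 N
  binomialTerm-absorb u (suc i) (suc N) = begin-equality
    fromℕ (suc (suc i)) * (b₂ + u * b₁)
      ≈⟨ distribˡ _ _ _ ⟩
    fromℕ (suc (suc i)) * b₂ + fromℕ (suc (suc i)) * (u * b₁)
      ≈⟨ +-congʳ (binomialTerm-absorb u (suc i) N) ⟩
    (n - (1# + j)) * (u * b₁) + (1# + (1# + j)) * (u * b₁)
      ≈⟨ solve 4 (λ n j u b → (n :- (con (+ 1) :+ j)) :* (u :* b) :+ (con (+ 1) :+ (con (+ 1) :+ j)) :* (u :* b) :=
                    (n :- j) :* (u :* b) :+ u :* ((con (+ 1) :+ j) :* b)) refl n j u b₁ ⟩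
    (n - j) * (u * b₁) + u * (fromℕ (suc i) * b₁)
      ≈⟨ +-congˡ (*-congˡ (binomialTerm-absorb u i N)) ⟩
    (n - j) * (u * b₁) + u * ((n - j) * (u * b₀))
      ≈⟨ solve 5 (λ n j u b c → (n :- j) :* (u :* b) :+ u :* ((n :- j) :* (u :* c)) :=
                    (con (+ 1) :+ n :- (con (+ 1) :+ j)) :* (u :* (b :+ u :* c))) refl n j u b₁ b₀ ⟩
    (fromℕ (suc N) - fromℕ (suc i)) * (u * (b₁ + u * b₀)) ∎
    where
    open ≤-Reasoning
    n = fromℕ N
    j = fromℕ i
    b₀ = binomialTerm u i N
    b₁ = binomialTerm u (suc i) N
    b₂ = binomialTerm u (suc (suc i)) N

  0≤binomialTerm : ∀ {u} i N → 0# ≤ u → 0# ≤ binomialTerm u i N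
  0≤binomialTerm zero    N       0≤u = 0≤1
  0≤binomialTerm (suc i) zero    0≤u = ≤-refl
  0≤binomialTerm (suc i) (suc N) 0≤u = 0≤+ (0≤binomialTerm (suc i) N 0≤u) (0≤* 0≤u (0≤binomialTerm i N 0≤u))

  -- A bound, uniform in N, on the difference of the i-th terms of exp x and (1 + x/N)ᴺ, divided by
  -- u = x/N. In closed form it is (i choose 2) xⁱ⁻¹ / i! for i ≥ 1.
  gap : Carrier → ℕ → Carrier
  gap x zero    = 0#
  gap x (suc i) = (x * gap x i + fromℕ i * expTerm x i) / fromℕ (suc i)

  -- With N u = x, absorption reads (i + 1) b′ = x b - i u b, against (i + 1) e′ = x e for the
  -- exponential series. Discarding the last term of the former gives the upper bound; keeping it
  -- gives the bound on the gap, where the first half of the induction hypothesis replaces b by e.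
  binomialTerm-close : ∀ {u x} N → 0# ≤ u → fromℕ N * u ≈ x → ∀ i →
                       binomialTerm u i N ≤ expTerm x i × expTerm x i - binomialTerm u i N ≤ u * gap x i
  binomialTerm-close {u} {x} N 0≤u Nu≈x zero =
    inj₂ (sym (expTerm-0 x)) ,
    inj₂ (trans (+-congʳ (expTerm-0 x)) (solve 1 (λ u → con (+ 1) :- con (+ 1) := u :* con (+ 0)) refl u))
  binomialTerm-close {u} {x} N 0≤u Nu≈x (suc i) with binomialTerm-close N 0≤u Nu≈x i
  ... | b≤e , e-b≤ug =
    *-cancelˡ-≤ (0<fromℕ i) (begin
      S * b′                     ≈⟨ Sb′ ⟩
      x * b - j * (u * b)        ≤⟨ ≤-by (0≤+ (0≤* 0≤x (≤⇒0≤- b≤e)) (0≤* (0≤fromℕ i) 0≤ub))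
                                     (solve 4 (λ x b e d → x :* e :- (x :* b :- d) := x :* (e :- b) :+ d) refl x b e (j * (u * b))) ⟩
      x * e                      ≈⟨ expTerm-suc x i ⟨
      S * e′                     ∎) ,
    *-cancelˡ-≤ (0<fromℕ i) (begin
      S * (e′ - b′)              ≈⟨ solve 3 (λ S e b → S :* (e :- b) := S :* e :- S :* b) refl S e′ b′ ⟩
      S * e′ - S * b′            ≈⟨ +-cong (expTerm-suc x i) (-‿cong Sb′) ⟩
      x * e - (x * b - j * (u * b))
        ≤⟨ ≤-by (0≤+ (0≤* 0≤x (≤⇒0≤- e-b≤ug)) (0≤* (0≤* (0≤fromℕ i) 0≤u) (≤⇒0≤- b≤e)))
             (solve 6 (λ x b e j u g → u :* (x :* g :+ j :* e) :- (x :* e :- (x :* b :- j :* (u :* b))) :=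
                 x :* (u :* g :- (e :- b)) :+ j :* u :* (e :- b)) refl x b e j u g) ⟩
      u * (x * g + j * e)        ≈⟨ *-congˡ (*-/-cancel _ (0<fromℕ i)) ⟨
      u * (S * gap x (suc i))    ≈⟨ solve 3 (λ u S g → u :* (S :* g) := S :* (u :* g)) refl u S (gap x (suc i)) ⟩
      S * (u * gap x (suc i))    ∎)
    where
    open ≤-Reasoning
    S = fromℕ (suc i)
    j = fromℕ i
    b = binomialTerm u i N
    b′ = binomialTerm u (suc i) N
    e = expTerm x i
    e′ = expTerm x (suc i)
    g = gap x i
    0≤x : 0# ≤ x
    0≤x = ≤-trans (0≤* (0≤fromℕ N) 0≤u) (inj₂ Nu≈x)
    0≤ub : 0# ≤ u * b
    0≤ub = 0≤* 0≤u (0≤binomialTerm i N 0≤u)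
    Sb′ : S * b′ ≈ x * b - j * (u * b)
    Sb′ = trans (binomialTerm-absorb u i N) (trans
      (solve 4 (λ n j u b → (n :- j) :* (u :* b) := n :* u :* b :- j :* (u :* b)) refl (fromℕ N) j u b)
      (+-congʳ (*-congʳ Nu≈x)))

  expTerm-neg : ∀ x i → expTerm (- x) i ≈ sign i * expTerm x i
  expTerm-neg x i = trans (*-congʳ (trans
    (^-congˡ i (solve 1 (λ x → :- x := :- con (+ 1) :* x) refl x)) (^-distrib-* (- 1#) x i))) (*-assoc _ _ _)

  -- The errors add up term by term: as `sign i` is 1 or -1, each costs at most `u * gap x i`.
  expSum-neg-close : ∀ {u x} N → 0# ≤ u → fromℕ N * u ≈ x → ∀ r →
                     expSum (- x) r ≤ truncated u r N + u * Σ< (gap x) r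
  expSum-neg-close {u} N 0≤u Nu≈x zero = inj₂ (solve 1 (λ u → con (+ 0) := con (+ 0) :+ u :* con (+ 0)) refl u)
  expSum-neg-close {u} {x} N 0≤u Nu≈x (suc r) with binomialTerm-close N 0≤u Nu≈x r
  ... | b≤e , e-b≤ug = begin
    expSum (- x) r + expTerm (- x) r
      ≤⟨ +-mono-≤ (expSum-neg-close N 0≤u Nu≈x r) (inj₂ (expTerm-neg x r)) ⟩
    H + u * G + s * e
      ≈⟨ solve 6 (λ H u G s e b → H :+ u :* G :+ s :* e := H :+ u :* G :+ (s :* b :+ s :* (e :- b))) refl H u G s e b ⟩
    H + u * G + (s * b + s * (e - b))
      ≤⟨ +-mono-≤ ≤-refl (+-mono-≤ ≤-refl (≤-trans (proj₁ (sign*≤ r (≤⇒0≤- b≤e))) e-b≤ug)) ⟩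
    H + u * G + (s * b + u * g)
      ≈⟨ solve 5 (λ H u G p g → H :+ u :* G :+ (p :+ u :* g) := H :+ p :+ u :* (G :+ g)) refl H u G (s * b) g ⟩
    H + s * b + u * (G + g) ∎
    where
    open ≤-Reasoning
    H = truncated u r N
    G = Σ< (gap x) r
    s = sign r
    e = expTerm x r
    b = binomialTerm u r N
    g = gap x r

  0≤gap : ∀ {x} i → 0# ≤ x → 0# ≤ gap x i
  0≤gap zero    0≤x = ≤-refl
  0≤gap (suc i) 0≤x = 0≤/ (0≤+ (0≤* 0≤x (0≤gap i 0≤x)) (0≤* (0≤fromℕ i) (0≤expTerm i 0≤x))) (0<fromℕ i)

  -- Letting N → ∞ in the Bonferroni inequality for u = x / N.
  expSum-even-neg : ∀ {x} n → 0# ≤ x → expSum (- x) (n ℕ.+ n) ≤ 1#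
  expSum-even-neg {x} n 0≤x = ≮⇒≥ λ 1<T →
    let γ = expSum (- x) r - 1#
        0<γ = <⇒0<- 1<T
    -- The summand x makes u = x/N at most 1, as the Bonferroni inequality requires. The summand x G
    -- / γ makes the total error u G smaller than the supposed excess γ.
    in archimedean (x + x * G / γ) λ where
      (zero , B<0) → ≤⇒≯ (0≤+ 0≤x (0≤/ (0≤* 0≤x 0≤G) 0<γ)) B<0
      (suc N , B<N) →
        let M = fromℕ (suc N)
            0<M = 0<fromℕ N
            u = x / M
            0≤u = 0≤/ 0≤x 0<M
            Mu≈x = *-/-cancel x 0<M
            x≤B = ≤-by (0≤/ (0≤* 0≤x 0≤G) 0<γ) (solve 2 (λ x y → x :+ y :- x := y) refl x (x * G / γ))
            u≤1 = /-≤ 0<M (≤-trans (≤-trans x≤B (inj₁ B<N)) (inj₂ (sym (*-identityʳ M))))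
            γ≤uG = ≤-trans (+-mono-≤ (expSum-neg-close (suc N) 0≤u Mu≈x r) ≤-refl)
              (≤-trans (+-mono-≤ (+-mono-≤ (truncated≤1 0≤u u≤1 (suc N)) ≤-refl) ≤-refl)
                (inj₂ (solve 1 (λ y → con (+ 1) :+ y :- con (+ 1) := y) refl (u * G))))
            open ≤-Reasoning
        in <-irrefl refl (begin-strict
          x * G                     ≈⟨ *-/-cancel (x * G) 0<γ ⟨
          γ * (x * G / γ)           ≤⟨ *-monoˡ-≤ (inj₁ 0<γ) (≤-by 0≤x (solve 2 (λ x y → x :+ y :- y := x) refl x (x * G / γ))) ⟩
          γ * (x + x * G / γ)       <⟨ *-monoˡ-< 0<γ B<N ⟩
          γ * M                     ≤⟨ *-monoʳ-≤ (inj₁ 0<M) γ≤uG ⟩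
          u * G * M                 ≈⟨ solve 3 (λ u G M → u :* G :* M := M :* u :* G) refl u G M ⟩
          M * u * G                 ≈⟨ *-congʳ Mu≈x ⟩
          x * G                     ∎)
    where
    r = n ℕ.+ n
    G = Σ< (gap x) r
    0≤G : 0# ≤ G
    0≤G = 0≤Σ< r (λ i → 0≤gap i 0≤x)
    truncated≤1 : ∀ {u} → 0# ≤ u → u ≤ 1# → ∀ N → truncated u r N ≤ 1#
    truncated≤1 {u} 0≤u u≤1 N = begin
      truncated u r N
        ≤⟨ ≤-by (bonferroni 0≤u u≤1 N r) (trans (sym (*-identityˡ _)) (*-congʳ (sym (sign-double n)))) ⟩
      (1# - u) ^ N
        ≤⟨ ^-monoˡ-≤ N (≤⇒0≤- u≤1) (≤-by 0≤u (solve 1 (λ u → con (+ 1) :- (con (+ 1) :- u) := u) refl u)) ⟩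
      1# ^ N
        ≈⟨ 1^ N ⟩
      1# ∎
      where open ≤-Reasoning

  -- The even truncations, of length `N + N`, are cofinal, so their bound passes to the limit.
  exp-nonpositive : ∀ {l E} → l ≤ 0# → IsExp l E → E ≤ 1#
  exp-nonpositive {l} l≤0 exp = converges-≤ exp λ N → N ℕ.+ N , ℕ.m≤m+n N N ,
    ≤-trans (inj₂ (trans (sum≈Σ< (expTerm l) (N ℕ.+ N)) (expSum-cong (N ℕ.+ N) (sym (-‿involutive l)))))
            (expSum-even-neg N (0≤-neg l≤0))

-- A Chernoff bound with integer exponents.

triangular : ℕ → ℕ
triangular zero    = 0
triangular (suc n) = suc n ℕ.+ triangular n

2*triangular : ∀ n → 2 ℕ.* triangular n ≡ n ℕ.* suc n
2*triangular zero    = ≡.refl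
2*triangular (suc n) = ≡.trans (ℕ.*-distribˡ-+ 2 (suc n) (triangular n)) (≡.trans
  (≡.cong (2 ℕ.* suc n ℕ.+_) (2*triangular n))
  (S.solve 1 (λ n → S.con 2 S.:* (S.con 1 S.:+ n) S.:+ n S.:* (S.con 1 S.:+ n) S.:= (S.con 1 S.:+ n) S.:* (S.con 2 S.:+ n)) ≡.refl n))
  where module S = ℕSolver.+-*-Solver

-- Puts the exponent of κ produced by `chernoff` into a form to which `κ^4Q≤z` applies. With J the
-- argument of `triangular`, the quadratic part J² m / 2 matches the right side exactly, and the
-- linear part J m / 2 is at most the contribution of the final `D`; the summand inserted below is
-- twice the difference.
triangular-bound : ∀ m M D q →
  triangular (suc M ℕ.* (4 ℕ.* D ℕ.* q)) ℕ.* m ℕ.≤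
  (4 ℕ.* (m ℕ.* (suc M ℕ.* suc M) ℕ.* q)) ℕ.* (2 ℕ.* D ℕ.* D ℕ.* q ℕ.+ D)
triangular-bound m M D q = ℕ.*-cancelˡ-≤ 2 (begin
  2 ℕ.* (triangular J ℕ.* m)    ≡⟨ ℕ.*-assoc 2 (triangular J) m ⟨
  2 ℕ.* triangular J ℕ.* m      ≡⟨ ≡.cong (ℕ._* m) (2*triangular J) ⟩
  J ℕ.* suc J ℕ.* m             ≤⟨ ℕ.m≤m+n _ (4 ℕ.* m ℕ.* suc M ℕ.* q ℕ.* D ℕ.* (1 ℕ.+ 2 ℕ.* M)) ⟩
  J ℕ.* suc J ℕ.* m ℕ.+ 4 ℕ.* m ℕ.* suc M ℕ.* q ℕ.* D ℕ.* (1 ℕ.+ 2 ℕ.* M)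
    ≡⟨ S.solve 4 (λ m M D q →
         let M′ = S.con 1 S.:+ M
             J′ = M′ S.:* (S.con 4 S.:* D S.:* q)
         in J′ S.:* (S.con 1 S.:+ J′) S.:* m S.:+ S.con 4 S.:* m S.:* M′ S.:* q S.:* D S.:* (S.con 1 S.:+ S.con 2 S.:* M) S.:=
            S.con 2 S.:* (S.con 4 S.:* (m S.:* (M′ S.:* M′) S.:* q) S.:* (S.con 2 S.:* D S.:* D S.:* q S.:+ D)))
         ≡.refl m M D q ⟩
  2 ℕ.* (4 ℕ.* (m ℕ.* (suc M ℕ.* suc M) ℕ.* q) ℕ.* (2 ℕ.* D ℕ.* D ℕ.* q ℕ.+ D)) ∎)
  where
  module S = ℕSolver.+-*-Solver
  open ℕ.≤-Reasoning
  J = suc M ℕ.* (4 ℕ.* D ℕ.* q)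

module Chernoff (ℝ : RealNumbers) where
  open Reals ℝ
  open Exponential ℝ

  archimedean* : ∀ {γ} → 0# < γ → ∀ B → ¬ ¬ ∃ λ n → B < fromℕ n * γ
  archimedean* {γ} 0<γ B ¬n = archimedean (B / γ) λ (n , B/γ<n) →
    ¬n (n , <-respˡ (*-/-cancel B 0<γ) (<-respʳ (*-comm γ (fromℕ n)) (*-monoˡ-< 0<γ B/γ<n)))

  -- From the tangent inequality at b = A′ for the running mean A of c copies of
  -- w and d ones: Aⁿ ≤ A′ⁿ⁺¹ when a further one turns A into A′.
  weighted-am-gm : ∀ c d {w A} → 0# ≤ w → 0# ≤ A →
                   fromℕ (d ℕ.+ c) * A ≈ fromℕ c * w + fromℕ d → w ^ c ≤ A ^ (d ℕ.+ c)
  weighted-am-gm zero zero 0≤w 0≤A eq = ≤-refl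
  weighted-am-gm (suc c) zero {w} 0≤w 0≤A eq =
    ^-monoˡ-≤ (suc c) 0≤w (inj₂ (*-cancelˡ-≈ (0<fromℕ c) (trans (sym (+-identityʳ _)) (sym eq))))
  weighted-am-gm c (suc d) {w} {A′} 0≤w 0≤A′ eq with d ℕ.+ c in n≡
  -- There is no earlier entry and hence no mean A to compare with; the only entry is 1, so A′ is 1.
  ... | zero = begin
    w ^ c          ≡⟨ ≡.cong (w ^_) c≡0 ⟩
    1#             ≈⟨ A′≈1 ⟨
    A′             ≈⟨ *-identityʳ A′ ⟨
    A′ * 1#        ∎
    where
    open ≤-Reasoning
    c≡0 = ℕ.m+n≡0⇒n≡0 d n≡
    d≡0 = ℕ.m+n≡0⇒m≡0 d n≡
    A′≈1 : A′ ≈ 1#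
    A′≈1 = begin-equality
      A′                            ≈⟨ solve 1 (λ A → A := (con (+ 1) :+ con (+ 0)) :* A) refl A′ ⟩
      fromℕ 1 * A′                  ≈⟨ eq ⟩
      fromℕ c * w + fromℕ (suc d)   ≡⟨ ≡.cong₂ (λ c d → fromℕ c * w + fromℕ (suc d)) c≡0 d≡0 ⟩
      0# * w + fromℕ 1              ≈⟨ solve 1 (λ w → con (+ 0) :* w :+ (con (+ 1) :+ con (+ 0)) := con (+ 1)) refl w ⟩
      1#                            ∎
  ... | suc n = begin
    w ^ c                           ≤⟨ weighted-am-gm c d 0≤w 0≤A (trans (*-congʳ (reflexive (≡.cong fromℕ n≡))) NA≈) ⟩
    A ^ (d ℕ.+ c)                   ≡⟨ ≡.cong (A ^_) n≡ ⟩
    A ^ suc n                       ≤⟨ ≤-by (≤⇒0≤- (tangent (suc n) 0≤A 0≤A′)) step ⟩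
    A′ ^ suc (suc n)                ∎
    where
    open ≤-Reasoning
    N = fromℕ (suc n)
    A = (fromℕ c * w + fromℕ d) / N
    0≤A : 0# ≤ A
    0≤A = 0≤/ (0≤+ (0≤* (0≤fromℕ c) 0≤w) (0≤fromℕ d)) (0<fromℕ n)
    NA≈ : N * A ≈ fromℕ c * w + fromℕ d
    NA≈ = *-/-cancel _ (0<fromℕ n)
    -- Appending a 1 moves the mean by (A - 1)/(N + 1). This cancels the factor N + 1 in `tangent`,
    -- whose last term becomes Aⁿ⁺² - Aⁿ⁺¹.
    A′-A : (1# + N) * (A - A′) ≈ A - 1#
    A′-A = begin-equality
      (1# + N) * (A - A′)           ≈⟨ solve 3 (λ N A A′ → (con (+ 1) :+ N) :* (A :- A′) := A :+ N :* A :- (con (+ 1) :+ N) :* A′) refl N A A′ ⟩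
      A + N * A - (1# + N) * A′     ≈⟨ +-cong (+-congˡ NA≈) (-‿cong eq) ⟩
      A + (fromℕ c * w + fromℕ d) - (fromℕ c * w + (1# + fromℕ d))
        ≈⟨ solve 3 (λ A x d → A :+ (x :+ d) :- (x :+ (con (+ 1) :+ d)) := A :- con (+ 1)) refl A (fromℕ c * w) (fromℕ d) ⟩
      A - 1#                        ∎
    step : A′ ^ suc (suc n) - A ^ suc n ≈
           A′ ^ suc (suc n) + fromℕ (suc (suc n)) * (A ^ suc n * (A - A′)) - A ^ suc (suc n)
    step = begin-equality
      A′ ^ suc (suc n) - A ^ suc n
        ≈⟨ solve 3 (λ X Y A → X :- Y := X :+ Y :* (A :- con (+ 1)) :- A :* Y) refl (A′ ^ suc (suc n)) (A ^ suc n) A ⟩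
      A′ ^ suc (suc n) + A ^ suc n * (A - 1#) - A ^ suc (suc n)
        ≈⟨ +-congʳ (+-congˡ (*-congˡ A′-A)) ⟨
      A′ ^ suc (suc n) + A ^ suc n * ((1# + N) * (A - A′)) - A ^ suc (suc n)
        ≈⟨ +-congʳ (+-congˡ (solve 3 (λ Y S d → Y :* (S :* d) := S :* (Y :* d)) refl (A ^ suc n) (1# + N) (A - A′))) ⟩
      A′ ^ suc (suc n) + (1# + N) * (A ^ suc n * (A - A′)) - A ^ suc (suc n) ∎

  mgf : Carrier → Carrier → ℕ → Carrier
  mgf z p j = 1# + p * (z ^ j - 1#)

  module Base (Q : ℕ) where

    -- With z = eʰ: w = e⁻ʰ and κ = (z + w + 2) / 4 = cosh² (h / 2).
    y z w κ : Carrier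
    y = 1# / fromℕ (suc Q)
    z = 1# + y
    w = z ⁻¹
    κ = 1# + y * (1# - w) / fromℕ 4

    Qy≈1 : fromℕ (suc Q) * y ≈ 1#
    Qy≈1 = *-/-cancel 1# (0<fromℕ Q)

    0<y : 0# < y
    0<y = *-pos 0<1 (0<⁻¹ (0<fromℕ Q))

    1≤z : 1# ≤ z
    1≤z = ≤-by (inj₁ 0<y) (solve 1 (λ y → con (+ 1) :+ y :- con (+ 1) := y) refl y)

    0<z : 0# < z
    0<z = <-≤-trans 0<1 1≤z

    zw≈1 : z * w ≈ 1#
    zw≈1 = *-⁻¹ 0<z

    0≤w : 0# ≤ w
    0≤w = inj₁ (0<⁻¹ 0<z)

    yw≈1-w : y * w ≈ 1# - w
    yw≈1-w = trans (solve 2 (λ y w → y :* w := (con (+ 1) :+ y) :* w :- w) refl y w) (+-congʳ zw≈1)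

    w≤1 : w ≤ 1#
    w≤1 = ≤-by (0≤* (inj₁ 0<y) 0≤w) (sym yw≈1-w)

    -- As z is (Q + 2)/(Q + 1), its inverse w is (Q + 1)/(Q + 2).
    [Q+2][1-w]≈1 : (1# + fromℕ (suc Q)) * (1# - w) ≈ 1#
    [Q+2][1-w]≈1 = begin-equality
      (1# + q) * (1# - w)            ≈⟨ solve 2 (λ q v → (con (+ 1) :+ q) :* v := v :+ q :* v) refl q (1# - w) ⟩
      1# - w + q * (1# - w)          ≈⟨ +-congˡ (*-congˡ yw≈1-w) ⟨
      1# - w + q * (y * w)           ≈⟨ solve 3 (λ q y w → con (+ 1) :- w :+ q :* (y :* w) := con (+ 1) :- w :+ q :* y :* w) refl q y w ⟩
      1# - w + q * y * w             ≈⟨ +-congˡ (*-congʳ Qy≈1) ⟩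
      1# - w + 1# * w                ≈⟨ solve 1 (λ w → con (+ 1) :- w :+ con (+ 1) :* w := con (+ 1)) refl w ⟩
      1#                             ∎
      where
      open ≤-Reasoning
      q = fromℕ (suc Q)

    4[κ-1] : fromℕ 4 * (κ - 1#) ≈ y * (1# - w)
    4[κ-1] = trans (*-congˡ (solve 1 (λ e → con (+ 1) :+ e :- con (+ 1) := e) refl (y * (1# - w) / fromℕ 4)))
                   (*-/-cancel _ (0<fromℕ 3))

    4κ≈ : fromℕ 4 * κ ≈ z + w + fromℕ 2
    4κ≈ = begin-equality
      fromℕ 4 * κ                            ≈⟨ solve 1 (λ κ → con (+ 4) :* κ := con (+ 4) :* (κ :- con (+ 1)) :+ con (+ 4)) refl κ ⟩
      fromℕ 4 * (κ - 1#) + fromℕ 4           ≈⟨ +-congʳ 4[κ-1] ⟩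
      y * (1# - w) + fromℕ 4                 ≈⟨ solve 2 (λ y w → y :* (con (+ 1) :- w) :+ con (+ 4) := y :- y :* w :+ con (+ 4)) refl y w ⟩
      y - y * w + fromℕ 4                    ≈⟨ +-congʳ (+-congˡ (-‿cong yw≈1-w)) ⟩
      y - (1# - w) + fromℕ 4                 ≈⟨ solve 2 (λ y w → y :- (con (+ 1) :- w) :+ con (+ 4) := con (+ 1) :+ y :+ w :+ con (+ 2)) refl y w ⟩
      z + w + fromℕ 2                        ∎
      where open ≤-Reasoning

    1≤κ : 1# ≤ κ
    1≤κ = ≤-by (0≤/ (0≤* (inj₁ 0<y) (≤⇒0≤- w≤1)) (0<fromℕ 3))
      (solve 1 (λ e → con (+ 1) :+ e :- con (+ 1) := e) refl (y * (1# - w) / fromℕ 4))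

    0≤κ : 0# ≤ κ
    0≤κ = ≤-trans 0≤1 1≤κ

    -- With v = 1 - w and n = 4 (Q + 1) one has κ = 1 + v/n and z = 1/(1 - v), so this is (1 + v/n)ⁿ
    -- ≤ 1/(1 - v). The tangent at κ, evaluated at 1, gives κⁿ ≤ 1 + n κⁿ⁻¹ (κ - 1) ≤ 1 + v κⁿ.
    κ^4Q≤z : κ ^ (4 ℕ.* suc Q) ≤ z
    κ^4Q≤z = begin
      K                    ≈⟨ *-identityʳ K ⟨
      K * 1#               ≈⟨ *-congˡ zw≈1 ⟨
      K * (z * w)          ≈⟨ solve 3 (λ K z w → K :* (z :* w) := z :* (K :* w)) refl K z w ⟩
      z * (K * w)          ≤⟨ *-monoˡ-≤ (inj₁ 0<z) Kw≤1 ⟩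
      z * 1#               ≈⟨ *-identityʳ z ⟩
      z                    ∎
      where
      open ≤-Reasoning
      n = 4 ℕ.* suc Q
      K = κ ^ n
      n[κ-1] : fromℕ n * (κ - 1#) ≈ 1# - w
      n[κ-1] = begin-equality
        fromℕ n * (κ - 1#)                             ≈⟨ *-congʳ (fromℕ-* 4 (suc Q)) ⟩
        fromℕ 4 * fromℕ (suc Q) * (κ - 1#)             ≈⟨ solve 3 (λ a q e → a :* q :* e := q :* (a :* e)) refl (fromℕ 4) (fromℕ (suc Q)) (κ - 1#) ⟩
        fromℕ (suc Q) * (fromℕ 4 * (κ - 1#))           ≈⟨ *-congˡ 4[κ-1] ⟩
        fromℕ (suc Q) * (y * (1# - w))                 ≈⟨ *-assoc _ _ _ ⟨
        fromℕ (suc Q) * y * (1# - w)                   ≈⟨ *-congʳ Qy≈1 ⟩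
        1# * (1# - w)                                  ≈⟨ *-identityˡ _ ⟩
        1# - w                                         ∎
      k = κ ^ ℕ.pred n
      Kw≤1 : K * w ≤ 1#
      Kw≤1 = ≤-by
        (0≤+ (≤⇒0≤- (≤-trans (tangent (ℕ.pred n) 0≤κ 0≤1) (+-mono-≤ (inj₂ (1^ n)) ≤-refl)))
             (0≤* (0≤* (0≤fromℕ n) (≤⇒0≤- 1≤κ)) (0≤* (0≤^ (ℕ.pred n) 0≤κ) (≤⇒0≤- 1≤κ))))
        (begin-equality
          1# - κ * k * w
            ≈⟨ solve 3 (λ κ k w → con (+ 1) :- κ :* k :* w := con (+ 1) :- κ :* k :+ κ :* k :* (con (+ 1) :- w)) refl κ k w ⟩
          1# - κ * k + κ * k * (1# - w)
            ≈⟨ +-congˡ (*-congˡ n[κ-1]) ⟨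
          1# - κ * k + κ * k * (fromℕ n * (κ - 1#))
            ≈⟨ solve 3 (λ κ k n → con (+ 1) :- κ :* k :+ κ :* k :* (n :* (κ :- con (+ 1))) :=
                  (con (+ 1) :+ n :* (k :* (κ :- con (+ 1))) :- κ :* k) :+ n :* (κ :- con (+ 1)) :* (k :* (κ :- con (+ 1))))
                 refl κ k (fromℕ n) ⟩
          (1# + fromℕ n * (k * (κ - 1#)) - κ * k) + fromℕ n * (κ - 1#) * (k * (κ - 1#)) ∎)

    -- Since z w = 1 and z + w = 4 κ - 2, the right side minus the left is (κ - 1)(a - d)². With a =
    -- 1 - p and d = p zʲ this compares three consecutive values of the moment generating function,
    -- a discrete form of the bound 1/4 on the second derivative of its logarithm.
    log-convex : ∀ a d → (a + d * z) * (a + d * w) ≤ κ * ((a + d) * (a + d))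
    log-convex a d = ≤-by (0≤* (≤⇒0≤- 1≤κ) (0≤x*x (a - d))) (begin-equality
      κ * ((a + d) * (a + d)) - (a + d * z) * (a + d * w)
        ≈⟨ solve 5 (λ κ a d z w → κ :* ((a :+ d) :* (a :+ d)) :- (a :+ d :* z) :* (a :+ d :* w) :=
              κ :* ((a :+ d) :* (a :+ d)) :- (a :* a :+ d :* d :* (z :* w) :+ a :* d :* ((z :+ w :+ con (+ 2)) :- con (+ 2))))
             refl κ a d z w ⟩
      κ * ((a + d) * (a + d)) - (a * a + d * d * (z * w) + a * d * ((z + w + fromℕ 2) - fromℕ 2))
        ≈⟨ +-congˡ (-‿cong (+-cong (+-congˡ (*-congˡ zw≈1)) (*-congˡ (+-congʳ (sym 4κ≈))))) ⟩
      κ * ((a + d) * (a + d)) - (a * a + d * d * 1# + a * d * (fromℕ 4 * κ - fromℕ 2))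
        ≈⟨ solve 3 (λ κ a d → κ :* ((a :+ d) :* (a :+ d)) :- (a :* a :+ d :* d :* con (+ 1) :+ a :* d :* (con (+ 4) :* κ :- con (+ 2))) :=
              (κ :- con (+ 1)) :* ((a :- d) :* (a :- d))) refl κ a d ⟩
      (κ - 1#) * ((a - d) * (a - d)) ∎)
      where open ≤-Reasoning

    module _ {p : Carrier} (0≤p : 0# ≤ p) (p≤1 : p ≤ 1#) where

      B : ℕ → Carrier
      B = mgf z p

      b : Carrier
      b = 1# + p * (w - 1#)

      0≤b : 0# ≤ b
      0≤b = ≤-trans (0≤+ (≤⇒0≤- p≤1) (0≤* 0≤p 0≤w))
        (inj₂ (solve 2 (λ p w → con (+ 1) :- p :+ p :* w := con (+ 1) :+ p :* (w :- con (+ 1))) refl p w))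

      0<B : ∀ j → 0# < B j
      0<B j = 0<+ 0<1 (0≤* 0≤p (≤⇒0≤- (1≤^ j 1≤z)))

      z^1+j*w : ∀ j → z ^ suc j * w ≈ z ^ j
      z^1+j*w j = trans (solve 3 (λ z Z w → z :* Z :* w := z :* w :* Z) refl z (z ^ j) w)
                        (trans (*-congʳ zw≈1) (*-identityˡ _))

      -- Here `b` is the value of `B` at -1. By `log-convex`, each step multiplies the ratio of
      -- consecutive values by at most κ, starting from B 0 / B (-1) = 1 / b.
      B-ratio : ∀ j → B (suc j) * b ≤ κ ^ suc j * B j
      B-ratio zero = begin
        B 1 * b
          ≈⟨ *-cong (solve 2 (λ p z → con (+ 1) :+ p :* (z :* con (+ 1) :- con (+ 1)) := con (+ 1) :- p :+ p :* z) refl p z)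
                    (solve 2 (λ p w → con (+ 1) :+ p :* (w :- con (+ 1)) := con (+ 1) :- p :+ p :* w) refl p w) ⟩
        (1# - p + p * z) * (1# - p + p * w)
          ≤⟨ log-convex (1# - p) p ⟩
        κ * ((1# - p + p) * (1# - p + p))
          ≈⟨ solve 2 (λ κ p → κ :* ((con (+ 1) :- p :+ p) :* (con (+ 1) :- p :+ p)) := κ :* con (+ 1) :* (con (+ 1) :+ p :* (con (+ 1) :- con (+ 1)))) refl κ p ⟩
        κ * 1# * B 0 ∎
        where open ≤-Reasoning
      B-ratio (suc j) = *-cancelˡ-≤ (0<B j) (begin
        B j * (B (suc (suc j)) * b)
          ≈⟨ solve 3 (λ x y b → x :* (y :* b) := y :* x :* b) refl (B j) (B (suc (suc j))) b ⟩
        B (suc (suc j)) * B j * b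
          ≤⟨ *-monoʳ-≤ 0≤b convex ⟩
        κ * (B (suc j) * B (suc j)) * b
          ≈⟨ solve 3 (λ κ x b → κ :* (x :* x) :* b := κ :* x :* (x :* b)) refl κ (B (suc j)) b ⟩
        κ * B (suc j) * (B (suc j) * b)
          ≤⟨ *-monoˡ-≤ (0≤* 0≤κ (inj₁ (0<B (suc j)))) (B-ratio j) ⟩
        κ * B (suc j) * (κ ^ suc j * B j)
          ≈⟨ solve 4 (λ κ x K y → κ :* x :* (K :* y) := y :* (κ :* K :* x)) refl κ (B (suc j)) (κ ^ suc j) (B j) ⟩
        B j * (κ ^ suc (suc j) * B (suc j)) ∎)
        where
        open ≤-Reasoning
        d = p * z ^ suc j
        convex : B (suc (suc j)) * B j ≤ κ * (B (suc j) * B (suc j))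
        convex = begin
          B (suc (suc j)) * B j
            ≈⟨ *-cong (solve 3 (λ p z Z → con (+ 1) :+ p :* (z :* Z :- con (+ 1)) := con (+ 1) :- p :+ p :* Z :* z) refl p z (z ^ suc j))
                 (trans (+-congˡ (*-congˡ (+-congʳ (sym (z^1+j*w j)))))
                   (solve 3 (λ p w Z → con (+ 1) :+ p :* (Z :* w :- con (+ 1)) := con (+ 1) :- p :+ p :* Z :* w) refl p w (z ^ suc j))) ⟩
          (1# - p + d * z) * (1# - p + d * w)
            ≤⟨ log-convex (1# - p) d ⟩
          κ * ((1# - p + d) * (1# - p + d))
            ≈⟨ solve 3 (λ κ p Z → κ :* ((con (+ 1) :- p :+ p :* Z) :* (con (+ 1) :- p :+ p :* Z)) :=
                  κ :* ((con (+ 1) :+ p :* (Z :- con (+ 1))) :* (con (+ 1) :+ p :* (Z :- con (+ 1))))) refl κ p (z ^ suc j) ⟩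
          κ * (B (suc j) * B (suc j)) ∎

      -- The ratios telescope, and their exponents 1, ..., J add up to `triangular J`.
      B-bound : ∀ J → B J * b ^ J ≤ κ ^ triangular J
      B-bound zero = inj₂ (solve 1 (λ p → (con (+ 1) :+ p :* (con (+ 1) :- con (+ 1))) :* con (+ 1) := con (+ 1)) refl p)
      B-bound (suc J) = begin
        B (suc J) * (b * b ^ J)              ≈⟨ *-assoc _ _ _ ⟨
        B (suc J) * b * b ^ J                ≤⟨ *-monoʳ-≤ (0≤^ J 0≤b) (B-ratio J) ⟩
        κ ^ suc J * B J * b ^ J              ≈⟨ *-assoc _ _ _ ⟩
        κ ^ suc J * (B J * b ^ J)            ≤⟨ *-monoˡ-≤ (0≤^ (suc J) 0≤κ) (B-bound J) ⟩
        κ ^ suc J * κ ^ triangular J         ≈⟨ ^-homo-* κ (suc J) (triangular J) ⟨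
        κ ^ triangular (suc J)               ∎
        where open ≤-Reasoning

      module _ (M c : ℕ) (c≤M : c ℕ.≤ M) (Mp≈c : fromℕ M * p ≈ fromℕ c) where

        -- As p = c/M, `b` is the mean of c copies of w and M - c ones. This is the lower bound on
        -- `B` at -1 by which `b` is eliminated from `B-bound`.
        w^c≤b^M : w ^ c ≤ b ^ M
        w^c≤b^M = ≤-trans (weighted-am-gm c d 0≤w 0≤b (begin-equality
          fromℕ (d ℕ.+ c) * b
            ≡⟨ ≡.cong (λ n → fromℕ n * b) d+c≡M ⟩
          fromℕ M * b
            ≈⟨ solve 3 (λ M p w → M :* (con (+ 1) :+ p :* (w :- con (+ 1))) := M :+ M :* p :* (w :- con (+ 1))) refl (fromℕ M) p w ⟩
          fromℕ M + fromℕ M * p * (w - 1#)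
            ≈⟨ +-cong (trans (reflexive (≡.cong fromℕ (≡.sym d+c≡M))) (fromℕ-+ d c)) (*-congʳ Mp≈c) ⟩
          fromℕ d + fromℕ c + fromℕ c * (w - 1#)
            ≈⟨ solve 3 (λ d c w → d :+ c :+ c :* (w :- con (+ 1)) := c :* w :+ d) refl (fromℕ d) (fromℕ c) w ⟩
          fromℕ c * w + fromℕ d ∎)) (inj₂ (reflexive (≡.cong (b ^_) d+c≡M)))
          where
          open ≤-Reasoning
          d = M ℕ.∸ c
          d+c≡M = ℕ.m∸n+n≡m c≤M

        -- The share E = c N m of the exponent belongs to the mean. Multiplication by wᴱ removes it
        -- on the left, and `w^c≤b^M` absorbs wᴱ on the right, leaving the m-th power of the left
        -- side of `B-bound`.
        chernoff : ∀ {P} m N D → P * z ^ (N ℕ.* (m ℕ.* c ℕ.+ D)) ≤ B (M ℕ.* N) ^ m →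
                   P * z ^ (N ℕ.* D) ≤ κ ^ (triangular (M ℕ.* N) ℕ.* m)
        chernoff {P} m N D markov = begin
          P * z ^ (N ℕ.* D)
            ≈⟨ *-identityʳ _ ⟨
          P * z ^ (N ℕ.* D) * 1#
            ≈⟨ *-congˡ (trans (sym (^-distrib-* z w E)) (trans (^-congˡ E zw≈1) (1^ E))) ⟨
          P * z ^ (N ℕ.* D) * (z ^ E * w ^ E)
            ≈⟨ solve 4 (λ P x y w → P :* x :* (y :* w) := P :* (y :* x) :* w) refl P (z ^ (N ℕ.* D)) (z ^ E) (w ^ E) ⟩
          P * (z ^ E * z ^ (N ℕ.* D)) * w ^ E
            ≈⟨ *-congʳ (*-congˡ (trans (sym (^-homo-* z E (N ℕ.* D))) (reflexive (≡.cong (z ^_) exponent)))) ⟩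
          P * z ^ (N ℕ.* (m ℕ.* c ℕ.+ D)) * w ^ E
            ≤⟨ *-monoʳ-≤ (0≤^ E 0≤w) markov ⟩
          B J ^ m * w ^ E
            ≈⟨ *-congˡ (trans (sym (^-assocʳ w (c ℕ.* N) m)) (^-congˡ m (sym (^-assocʳ w c N)))) ⟩
          B J ^ m * ((w ^ c) ^ N) ^ m
            ≤⟨ *-monoˡ-≤ (0≤^ m (inj₁ (0<B J))) (^-monoˡ-≤ m (0≤^ N (0≤^ c 0≤w)) (^-monoˡ-≤ N (0≤^ c 0≤w) w^c≤b^M)) ⟩
          B J ^ m * ((b ^ M) ^ N) ^ m
            ≈⟨ ^-distrib-* (B J) ((b ^ M) ^ N) m ⟨
          (B J * (b ^ M) ^ N) ^ m
            ≈⟨ ^-congˡ m (*-congˡ (^-assocʳ b M N)) ⟩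
          (B J * b ^ J) ^ m
            ≤⟨ ^-monoˡ-≤ m (0≤* (inj₁ (0<B J)) (0≤^ J 0≤b)) (B-bound J) ⟩
          (κ ^ triangular J) ^ m
            ≈⟨ ^-assocʳ κ (triangular J) m ⟩
          κ ^ (triangular J ℕ.* m) ∎
          where
          open ≤-Reasoning
          J = M ℕ.* N
          E = c ℕ.* N ℕ.* m
          exponent : E ℕ.+ N ℕ.* D ≡ N ℕ.* (m ℕ.* c ℕ.+ D)
          exponent = S.solve 4 (λ c N m D → c S.:* N S.:* m S.:+ N S.:* D S.:= N S.:* (m S.:* c S.:+ D)) ≡.refl c N m D
            where module S = ℕSolver.+-*-Solver

  module _ {p P l : Carrier} (0≤p : 0# ≤ p) (p≤1 : p ≤ 1#) (0≤P : 0# ≤ P) (0≤l : 0# ≤ l)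
           (m M c D : ℕ) (c≤M : c ℕ.≤ suc M) (Mp≈c : fromℕ (suc M) * p ≈ fromℕ c)
           (markov : ∀ Q N → P * Base.z Q ^ (N ℕ.* (suc m ℕ.* c ℕ.+ D)) ≤ mgf (Base.z Q) p (suc M ℕ.* N) ^ suc m) where

    -- The choice N / Q = 4 D / (m M²) minimises the exponent in the Chernoff bound.
    chernoff-exp-at : ∀ q n →
      fromℕ D + l < fromℕ (suc q) * (fromℕ (2 ℕ.* D ℕ.* D) - fromℕ (suc m ℕ.* (suc M ℕ.* suc M)) * l) →
      expSum l n * P ≤ 1#
    chernoff-exp-at q′ n D+l<qγ = begin
      expSum l n * P                     ≤⟨ *-mono-≤ (≤-trans (0≤expSum n 0≤l) l≤) 0≤P l≤ P≤w^L ⟩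
      expSum (fromℕ L * u) n * w ^ L     ≈⟨ *-congˡ (^-congˡ L (solve 1 (λ w → w := con (+ 1) :- (con (+ 1) :- w)) refl w)) ⟩
      expSum (fromℕ L * u) n * (1# - u) ^ L
        ≤⟨ expSum-bound n L (≤⇒0≤- w≤1) (≤-by 0≤w (solve 1 (λ w → con (+ 1) :- (con (+ 1) :- w) := w) refl w)) ⟩
      1#                                 ∎
      where
      open ≤-Reasoning
      q = suc q′
      K = suc m ℕ.* (suc M ℕ.* suc M)
      X = 2 ℕ.* D ℕ.* D ℕ.* q
      -- `Base` is indexed by a predecessor, so `y` is 1 / (K q) and zᴺ stands for exp (4 D / K).
      open Base (ℕ.pred (K ℕ.* q))
      u = 1# - w
      N = 4 ℕ.* D ℕ.* q
      -- The exponent N D is 2 X. The part X + D pays for the powers of κ, and the rest L = X - D is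
      -- what remains as decay.
      e = X ℕ.+ D

      -- Because 1 + K q is the inverse of u, this amounts to l ≤ (X - D) u. It also shows D ≤ X, so
      -- that the truncated subtraction in `L` is a true one.
      X-D≥ : l + fromℕ (K ℕ.* q) * l ≤ fromℕ X - fromℕ D
      X-D≥ = ≤-by (≤⇒0≤- (inj₁ D+l<qγ)) (begin-equality
        fromℕ X - fromℕ D - (l + fromℕ (K ℕ.* q) * l)
          ≈⟨ +-cong (+-congʳ (fromℕ-* (2 ℕ.* D ℕ.* D) q)) (-‿cong (+-congˡ (*-congʳ (fromℕ-* K q)))) ⟩
        fromℕ (2 ℕ.* D ℕ.* D) * fromℕ q - fromℕ D - (l + fromℕ K * fromℕ q * l)
          ≈⟨ solve 5 (λ T q D l K → T :* q :- D :- (l :+ K :* q :* l) := q :* (T :- K :* l) :- (D :+ l)) refl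
               (fromℕ (2 ℕ.* D ℕ.* D)) (fromℕ q) (fromℕ D) l (fromℕ K) ⟩
        fromℕ q * (fromℕ (2 ℕ.* D ℕ.* D) - fromℕ K * l) - (fromℕ D + l) ∎)

      D≤X : D ℕ.≤ X
      D≤X = fromℕ-cancel-≤ (0≤-⇒≤ (≤-trans (0≤+ 0≤l (0≤* (0≤fromℕ (K ℕ.* q)) 0≤l)) X-D≥))

      L = X ℕ.∸ D
      D+L≡X : D ℕ.+ L ≡ X
      D+L≡X = ℕ.m+[n∸m]≡n D≤X

      N*D≡ : N ℕ.* D ≡ e ℕ.+ L
      N*D≡ = ≡.trans
        (S.solve 2 (λ D q → S.con 4 S.:* D S.:* q S.:* D S.:= S.con 2 S.:* D S.:* D S.:* q S.:+ S.con 2 S.:* D S.:* D S.:* q) ≡.refl D q)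
        (≡.trans (≡.cong (X ℕ.+_) (≡.sym D+L≡X)) (≡.sym (ℕ.+-assoc X D L)))
        where module S = ℕSolver.+-*-Solver

      l≤Lu : l ≤ fromℕ L * u
      l≤Lu = begin
        l                                          ≈⟨ *-identityʳ l ⟨
        l * 1#                                     ≈⟨ *-congˡ [Q+2][1-w]≈1 ⟨
        l * ((1# + fromℕ (K ℕ.* q)) * u)           ≈⟨ solve 3 (λ l k u → l :* ((con (+ 1) :+ k) :* u) := (l :+ k :* l) :* u) refl l (fromℕ (K ℕ.* q)) u ⟩
        (l + fromℕ (K ℕ.* q) * l) * u              ≤⟨ *-monoʳ-≤ (≤⇒0≤- w≤1) X-D≥ ⟩
        (fromℕ X - fromℕ D) * u                    ≈⟨ *-congʳ (+-congʳ (trans (reflexive (≡.cong fromℕ (≡.sym D+L≡X))) (fromℕ-+ D L))) ⟩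
        (fromℕ D + fromℕ L - fromℕ D) * u          ≈⟨ *-congʳ (solve 2 (λ D L → D :+ L :- D := L) refl (fromℕ D) (fromℕ L)) ⟩
        fromℕ L * u                                ∎

      l≤ : expSum l n ≤ expSum (fromℕ L * u) n
      l≤ = expSum-mono n 0≤l l≤Lu

      Pz^L≤1 : P * z ^ L ≤ 1#
      Pz^L≤1 = *-cancelˡ-≤ (0<^ e 0<z) (begin
        z ^ e * (P * z ^ L)                        ≈⟨ solve 3 (λ x P y → x :* (P :* y) := P :* (x :* y)) refl (z ^ e) P (z ^ L) ⟩
        P * (z ^ e * z ^ L)                        ≈⟨ *-congˡ (^-homo-* z e L) ⟨
        P * z ^ (e ℕ.+ L)                          ≡⟨ ≡.cong (λ k → P * z ^ k) N*D≡ ⟨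
        P * z ^ (N ℕ.* D)                          ≤⟨ chernoff 0≤p p≤1 (suc M) c c≤M Mp≈c (suc m) N D (markov (ℕ.pred (K ℕ.* q)) N) ⟩
        κ ^ (triangular (suc M ℕ.* N) ℕ.* suc m)   ≤⟨ ^-monoʳ-≤ 1≤κ (triangular-bound (suc m) M D q) ⟩
        κ ^ (4 ℕ.* (K ℕ.* q) ℕ.* e)                ≈⟨ ^-assocʳ κ (4 ℕ.* (K ℕ.* q)) e ⟨
        (κ ^ (4 ℕ.* (K ℕ.* q))) ^ e                ≤⟨ ^-monoˡ-≤ e (0≤^ (4 ℕ.* (K ℕ.* q)) 0≤κ) κ^4Q≤z ⟩
        z ^ e                                      ≈⟨ *-identityʳ _ ⟨
        z ^ e * 1#                                 ∎)

      P≤w^L : P ≤ w ^ L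
      P≤w^L = begin
        P                          ≈⟨ *-identityʳ P ⟨
        P * 1#                     ≈⟨ *-congˡ (trans (sym (^-distrib-* z w L)) (trans (^-congˡ L zw≈1) (1^ L))) ⟨
        P * (z ^ L * w ^ L)        ≈⟨ *-assoc _ _ _ ⟨
        P * z ^ L * w ^ L          ≤⟨ *-monoʳ-≤ (0≤^ L 0≤w) Pz^L≤1 ⟩
        1# * w ^ L                 ≈⟨ *-identityˡ _ ⟩
        w ^ L                      ∎

    -- The strictness leaves a positive gap 2 D² - K l, and a large q makes q times this gap
    -- outweigh the rounding loss D + l.
    chernoff-exp : fromℕ (suc m ℕ.* (suc M ℕ.* suc M)) * l < fromℕ (2 ℕ.* D ℕ.* D) →
                   ∀ n → expSum l n * P ≤ 1#
    chernoff-exp Kl<2D² n = ≤-stable λ ¬goal → archimedean* (<⇒0<- Kl<2D²) (fromℕ D + l) λ where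
      (zero , D+l<0) → ≤⇒≯ (0≤+ (0≤fromℕ D) 0≤l) (<-respʳ (zeroˡ _) D+l<0)
      (suc q , D+l<qγ) → ¬goal (chernoff-exp-at q n D+l<qγ)

-- Bounded search and averages over finite lists.

least-or-none : {P : ℕ → Set} → Decidable P → ∀ n →
                (∃ λ d → P d × (∀ e → P e → d ℕ.≤ e)) ⊎ (∀ e → e ℕ.≤ n → ¬ P e)
least-or-none P? zero with P? 0
... | yes P0 = inj₁ (0 , P0 , λ _ _ → ℕ.z≤n)
... | no ¬P0 = inj₂ λ where zero _ → ¬P0
least-or-none {P} P? (suc n) with least-or-none P? n
... | inj₁ found = inj₁ found
... | inj₂ none with P? (suc n)
...   | yes P1+n = inj₁ (suc n , P1+n , λ e Pe → ℕ.≰⇒> (λ e≤n → none e e≤n Pe))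
...   | no ¬P1+n = inj₂ none′
  where
  none′ : ∀ e → e ℕ.≤ suc n → ¬ P e
  none′ e e≤1+n Pe with ℕ.m≤n⇒m<n∨m≡n e≤1+n
  ... | inj₁ (ℕ.s≤s e≤n) = none e e≤n Pe
  ... | inj₂ ≡.refl = ¬P1+n Pe

module Averages (ℝ : RealNumbers) where
  open Reals ℝ
  open OverReals ℝ

  private variable A B C : Set

  ind : Bool → Carrier
  ind b = if b then 1# else 0#

  0≤ind : ∀ b → 0# ≤ ind b
  0≤ind true  = 0≤1
  0≤ind false = ≤-refl

  ind≤1 : ∀ b → ind b ≤ 1#
  ind≤1 true  = ≤-refl
  ind≤1 false = 0≤1

  ind-does-*-≤ : {X : Set} (d : Dec X) {a b : Carrier} → 0# ≤ b → (X → a ≤ b) → ind (does d) * a ≤ b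
  ind-does-*-≤ (yes x) 0≤b a≤b = ≤-trans (inj₂ (*-identityˡ _)) (a≤b x)
  ind-does-*-≤ (no  _) 0≤b a≤b = ≤-trans (inj₂ (zeroˡ _)) 0≤b

  ind-does-≤ : {X : Set} (d : Dec X) {b : Carrier} → 0# ≤ b → (X → 1# ≤ b) → ind (does d) ≤ b
  ind-does-≤ d 0≤b 1≤b = ≤-trans (inj₂ (sym (*-identityʳ _))) (ind-does-*-≤ d 0≤b 1≤b)

  total : List A → (A → Carrier) → Carrier
  total xs h = List.foldr (λ x a → h x + a) 0# xs

  total-mono : ∀ (xs : List A) {h k} → (∀ x → h x ≤ k x) → total xs h ≤ total xs k
  total-mono []       h≤k = ≤-refl
  total-mono (x ∷ xs) h≤k = +-mono-≤ (h≤k x) (total-mono xs h≤k)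

  total-cong : ∀ (xs : List A) {h k} → (∀ x → h x ≈ k x) → total xs h ≈ total xs k
  total-cong []       h≈k = refl
  total-cong (x ∷ xs) h≈k = +-cong (h≈k x) (total-cong xs h≈k)

  total-+ : ∀ (xs : List A) h k → total xs (λ x → h x + k x) ≈ total xs h + total xs k
  total-+ []       h k = sym (+-identityʳ 0#)
  total-+ (x ∷ xs) h k = trans (+-congˡ (total-+ xs h k))
    (solve 4 (λ a b c d → a :+ b :+ (c :+ d) := a :+ c :+ (b :+ d)) refl (h x) (k x) (total xs h) (total xs k))

  total-*ʳ : ∀ (xs : List A) h c → total xs (λ x → h x * c) ≈ total xs h * c
  total-*ʳ []       h c = sym (zeroˡ c)
  total-*ʳ (x ∷ xs) h c = trans (+-congˡ (total-*ʳ xs h c)) (sym (distribʳ c _ _))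

  total-const : ∀ (xs : List A) c → total xs (λ _ → c) ≈ fromℕ (length xs) * c
  total-const []       c = sym (zeroˡ c)
  total-const (x ∷ xs) c = trans (+-congˡ (total-const xs c))
    (solve 2 (λ c n → c :+ n :* c := (con (+ 1) :+ n) :* c) refl c (fromℕ (length xs)))

  total-1 : ∀ (xs : List A) → total xs (λ _ → 1#) ≈ fromℕ (length xs)
  total-1 xs = trans (total-const xs 1#) (*-identityʳ _)

  total-++ : ∀ (xs ys : List A) h → total (xs ++ ys) h ≈ total xs h + total ys h
  total-++ []       ys h = sym (+-identityˡ _)
  total-++ (x ∷ xs) ys h = trans (+-congˡ (total-++ xs ys h)) (sym (+-assoc _ _ _))

  total-map : ∀ (f : A → B) xs h → total (List.map f xs) h ≈ total xs (h ∘ f)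
  total-map f []       h = refl
  total-map f (x ∷ xs) h = +-congˡ (total-map f xs h)

  total-cartesianProductWith : ∀ (f : A → B → C) xs ys h →
    total (cartesianProductWith f xs ys) h ≈ total xs (λ x → total ys (λ y → h (f x y)))
  total-cartesianProductWith f []       ys h = refl
  total-cartesianProductWith f (x ∷ xs) ys h = trans (total-++ (List.map (f x) ys) _ h)
    (+-cong (total-map (f x) ys h) (total-cartesianProductWith f xs ys h))

  total-swap : ∀ (xs : List A) (ys : List B) (h : A → B → Carrier) →
    total xs (λ x → total ys (h x)) ≈ total ys (λ y → total xs (λ x → h x y))
  total-swap []       ys h = sym (trans (total-const ys 0#) (zeroʳ _))
  total-swap (x ∷ xs) ys h = trans (+-congˡ (total-swap xs ys h)) (sym (total-+ ys (h x) _))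

  length-cartesianProductWith : ∀ (f : A → B → C) xs ys →
    fromℕ (length (cartesianProductWith f xs ys)) ≈ fromℕ (length xs) * fromℕ (length ys)
  length-cartesianProductWith f xs ys = trans (sym (total-1 (cartesianProductWith f xs ys)))
    (trans (total-cartesianProductWith f xs ys (λ _ → 1#))
      (trans (total-const xs _) (*-congˡ (total-1 ys))))

  length-tuples : ∀ n (xs : List A) → fromℕ (length (tuples n xs)) ≈ fromℕ (length xs) ^ n
  length-tuples zero    xs = fromℕ-1
  length-tuples (suc n) xs = trans (length-cartesianProductWith _∷_ xs (tuples n xs)) (*-congˡ (length-tuples n xs))

  -- Independence of the coordinates: x to the power of a weight is a product over the coordinates,
  -- so its total factorises.
  total-tuples : ∀ n (xs : List A) (f : A → Bool) x →
    total (tuples n xs) (λ r → x ^ ‖ Vec.map f r ‖₁) ≈ total xs (λ u → if f u then x else 1#) ^ n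
  total-tuples zero    xs f x = +-identityʳ 1#
  total-tuples (suc n) xs f x = begin-equality
    total (tuples (suc n) xs) (λ r → x ^ ‖ Vec.map f r ‖₁)
      ≈⟨ total-cartesianProductWith _∷_ xs (tuples n xs) _ ⟩
    total xs (λ u → total (tuples n xs) (λ r → x ^ ‖ Vec.map f (u ∷ r) ‖₁))
      ≈⟨ total-cong xs (λ u → trans (total-cong (tuples n xs) (λ r → step (f u) ‖ Vec.map f r ‖₁))
           (trans (total-*ʳ (tuples n xs) _ _) (*-comm _ _))) ⟩
    total xs (λ u → (if f u then x else 1#) * total (tuples n xs) (λ r → x ^ ‖ Vec.map f r ‖₁))
      ≈⟨ total-*ʳ xs _ _ ⟩
    total xs (λ u → if f u then x else 1#) * total (tuples n xs) (λ r → x ^ ‖ Vec.map f r ‖₁)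
      ≈⟨ *-congˡ (total-tuples n xs f x) ⟩
    total xs (λ u → if f u then x else 1#) ^ suc n ∎
    where
    open ≤-Reasoning
    step : ∀ b k → x ^ ((if b then 1 else 0) ℕ.+ k) ≈ x ^ k * (if b then x else 1#)
    step true  k = *-comm _ _
    step false k = sym (*-identityʳ _)

  Nonempty : List A → Set
  Nonempty xs = 0# < fromℕ (length xs)

  nonempty-tuples : ∀ n (xs : List A) → Nonempty xs → Nonempty (tuples n xs)
  nonempty-tuples n xs ne = <-respʳ (sym (length-tuples n xs)) (0<^ n ne)

  nonempty-bitstrings : ∀ n → Nonempty (bitstrings n)
  nonempty-bitstrings n = nonempty-tuples n (false ∷ true ∷ []) (0<fromℕ 1)

  nonempty-× : ∀ (xs : List A) (ys : List B) → Nonempty xs → Nonempty ys → Nonempty (cartesianProduct xs ys)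
  nonempty-× xs ys nx ny = <-respʳ (sym (length-cartesianProductWith _,_ xs ys)) (*-pos nx ny)

  average-mono : ∀ (xs : List A) → Nonempty xs → ∀ {h k} → (∀ x → h x ≤ k x) → average xs h ≤ average xs k
  average-mono xs ne h≤k = *-monoʳ-≤ (inj₁ (0<⁻¹ ne)) (total-mono xs h≤k)

  average-cong : ∀ (xs : List A) {h k} → (∀ x → h x ≈ k x) → average xs h ≈ average xs k
  average-cong xs h≈k = *-congʳ (total-cong xs h≈k)

  average-+ : ∀ (xs : List A) h k → average xs (λ x → h x + k x) ≈ average xs h + average xs k
  average-+ xs h k = trans (*-congʳ (total-+ xs h k)) (distribʳ _ _ _)

  average-*ʳ : ∀ (xs : List A) h c → average xs (λ x → h x * c) ≈ average xs h * c
  average-*ʳ xs h c = trans (*-congʳ (total-*ʳ xs h c))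
    (solve 3 (λ t c i → t :* c :* i := t :* i :* c) refl (total xs h) c _)

  average-const : ∀ (xs : List A) → Nonempty xs → ∀ c → average xs (λ _ → c) ≈ c
  average-const xs ne c = trans (*-congʳ (total-const xs c))
    (trans (*-assoc _ _ _) (*-/-cancel c ne))

  average-≤ : ∀ (xs : List A) → Nonempty xs → ∀ {h c} → (∀ x → h x ≤ c) → average xs h ≤ c
  average-≤ xs ne {c = c} h≤c = ≤-trans (average-mono xs ne h≤c) (inj₂ (average-const xs ne c))

  ≤-average : ∀ (xs : List A) → Nonempty xs → ∀ {h c} → (∀ x → c ≤ h x) → c ≤ average xs h
  ≤-average xs ne {c = c} c≤h = ≤-trans (inj₂ (sym (average-const xs ne c))) (average-mono xs ne c≤h)

  /-* : ∀ a b {x y} → 0# < x → 0# < y → (a * b) / (x * y) ≈ (a / x) * (b / y)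
  /-* a b {x} {y} 0<x 0<y = *-cancelˡ-≈ (*-pos 0<x 0<y) (trans (*-/-cancel (a * b) (*-pos 0<x 0<y)) (sym (trans
    (solve 4 (λ x y u v → x :* y :* (u :* v) := x :* u :* (y :* v)) refl x y (a / x) (b / y))
    (*-cong (*-/-cancel a 0<x) (*-/-cancel b 0<y)))))

  /-^ : ∀ n a {x} → 0# < x → (a ^ n) / (x ^ n) ≈ (a / x) ^ n
  /-^ zero    a 0<x = *-⁻¹ 0<1
  /-^ (suc n) a 0<x = trans (/-* a (a ^ n) 0<x (0<^ n 0<x)) (*-congˡ (/-^ n a 0<x))

  average-tuples : ∀ n (xs : List A) → Nonempty xs → ∀ (f : A → Bool) x →
    average (tuples n xs) (λ r → x ^ ‖ Vec.map f r ‖₁) ≈ average xs (λ u → if f u then x else 1#) ^ n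
  average-tuples n xs ne f x = trans (*-cong (total-tuples n xs f x) (⁻¹-cong (length-tuples n xs))) (/-^ n _ ne)

  -- With xs the coins of the verifier and ys those of the prover, this reduces a randomised prover
  -- to the deterministic ones obtained by fixing its coins.
  average-×-≤ : ∀ (xs : List A) (ys : List B) → Nonempty xs → Nonempty ys → ∀ {h : A × B → Carrier} {c} →
    (∀ y → average xs (λ x → h (x , y)) ≤ c) → average (cartesianProduct xs ys) h ≤ c
  average-×-≤ xs ys nx ny {h} {c} avg≤c = /-≤ (nonempty-× xs ys nx ny) (begin
    total (cartesianProduct xs ys) h
      ≈⟨ total-cartesianProductWith _,_ xs ys h ⟩
    total xs (λ x → total ys (λ y → h (x , y)))
      ≈⟨ total-swap xs ys _ ⟩
    total ys (λ y → total xs (λ x → h (x , y)))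
      ≤⟨ total-mono ys (λ y → ≤-trans (inj₂ (sym (*-/-cancel _ nx))) (*-monoˡ-≤ (inj₁ nx) (avg≤c y))) ⟩
    total ys (λ _ → fromℕ (length xs) * c)
      ≈⟨ total-const ys _ ⟩
    fromℕ (length ys) * (fromℕ (length xs) * c)
      ≈⟨ solve 3 (λ a b c → a :* (b :* c) := b :* a :* c) refl (fromℕ (length ys)) (fromℕ (length xs)) c ⟩
    fromℕ (length xs) * fromℕ (length ys) * c
      ≈⟨ *-congʳ (length-cartesianProductWith _,_ xs ys) ⟨
    fromℕ (length (cartesianProduct xs ys)) * c ∎)
    where open ≤-Reasoning

  -- Writes the mean of a Boolean function as c/M with a natural number c, which makes the Chernoff
  -- exponents integers.
  total-ind : ∀ (xs : List A) (f : A → Bool) → ∃ λ c → c ℕ.≤ length xs × total xs (ind ∘ f) ≈ fromℕ c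
  total-ind []       f = 0 , ℕ.z≤n , refl
  total-ind (x ∷ xs) f with f x | total-ind xs f
  ... | true  | c , c≤n , eq = suc c , ℕ.s≤s c≤n , +-congˡ eq
  ... | false | c , c≤n , eq = c , ℕ.m≤n⇒m≤1+n c≤n , trans (+-identityˡ _) eq

  -- Hoeffding's inequality for the upper tail.

  Exceeds : (xs : List A) (f : A → Bool) (m : ℕ) (t : Carrier) → Vec A m → Set
  Exceeds xs f m t r = average xs (ind ∘ f) + t < fromℕ ‖ Vec.map f r ‖₁ / fromℕ m

  exceeds? : (xs : List A) (f : A → Bool) (m : ℕ) (t : Carrier) → Decidable (Exceeds xs f m t)
  exceeds? xs f m t r = _ <? _

  module Hoeffding (x : A) (xs′ : List A) (f : A → Bool) (m′ : ℕ) {t l : Carrier}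
                   (0≤t : 0# ≤ t) (0≤l : 0# ≤ l) (l≤2mt² : l ≤ fromℕ 2 * fromℕ (suc m′) * (t * t)) where
    open Exponential ℝ
    open Chernoff ℝ

    xs : List A
    xs = x ∷ xs′

    M m c : ℕ
    M = length xs
    m = suc m′
    c = proj₁ (total-ind xs f)

    ne : Nonempty xs
    ne = 0<fromℕ (length xs′)

    p P : Carrier
    p = average xs (ind ∘ f)
    P = Pr (tuples m xs) (exceeds? xs f m t)

    Mp≈c : fromℕ M * p ≈ fromℕ c
    Mp≈c = trans (*-/-cancel _ ne) (proj₂ (proj₂ (total-ind xs f)))

    0≤p : 0# ≤ p
    0≤p = ≤-average xs ne (0≤ind ∘ f)

    p≤1 : p ≤ 1#
    p≤1 = average-≤ xs ne (ind≤1 ∘ f)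

    neᵐ : Nonempty (tuples m xs)
    neᵐ = nonempty-tuples m xs ne

    average-if : ∀ y → average xs (λ u → if f u then y else 1#) ≈ 1# + p * (y - 1#)
    average-if y = begin-equality
      average xs (λ u → if f u then y else 1#)
        ≈⟨ average-cong xs (λ u → affine (f u)) ⟩
      average xs (λ u → 1# + ind (f u) * (y - 1#))
        ≈⟨ average-+ xs (λ _ → 1#) (λ u → ind (f u) * (y - 1#)) ⟩
      average xs (λ _ → 1#) + average xs (λ u → ind (f u) * (y - 1#))
        ≈⟨ +-cong (average-const xs ne 1#) (average-*ʳ xs (ind ∘ f) (y - 1#)) ⟩
      1# + p * (y - 1#) ∎
      where
      open ≤-Reasoning
      affine : ∀ b → (if b then y else 1#) ≈ 1# + ind b * (y - 1#)
      affine true  = solve 1 (λ y → y := con (+ 1) :+ con (+ 1) :* (y :- con (+ 1))) refl y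
      affine false = solve 1 (λ y → con (+ 1) := con (+ 1) :+ con (+ 0) :* (y :- con (+ 1))) refl y

    Beyond : ℕ → Set
    Beyond d = fromℕ M * (fromℕ m * t) < fromℕ d

    -- Multiplied by M m, the deviation p + t < S/m becomes m c + M m t < M S, so the natural number
    -- d = M S - m c lies beyond M m t. The bound d ≤ M m makes the search for the least such number
    -- finite.
    exceeds⇒beyond : ∀ r → Exceeds xs f m t r →
                     ∃ λ d → d ℕ.≤ M ℕ.* m × Beyond d × m ℕ.* c ℕ.+ d ≡ M ℕ.* ‖ Vec.map f r ‖₁
    exceeds⇒beyond r p+t<S/m =
      M ℕ.* S ℕ.∸ m ℕ.* c ,
      ℕ.≤-trans (ℕ.m∸n≤m _ (m ℕ.* c)) (ℕ.*-monoʳ-≤ M (‖‖₁-bound (Vec.map f r))) ,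
      <-by (<⇒0<- key) (begin-equality
        fromℕ (M ℕ.* S ℕ.∸ m ℕ.* c) - fromℕ M * (fromℕ m * t)
          ≈⟨ solve 3 (λ d e k → d :- k := e :+ d :- (e :+ k)) refl (fromℕ (M ℕ.* S ℕ.∸ m ℕ.* c)) (fromℕ (m ℕ.* c)) (fromℕ M * (fromℕ m * t)) ⟩
        fromℕ (m ℕ.* c) + fromℕ (M ℕ.* S ℕ.∸ m ℕ.* c) - (fromℕ (m ℕ.* c) + fromℕ M * (fromℕ m * t))
          ≈⟨ +-congʳ (fromℕ-+ (m ℕ.* c) (M ℕ.* S ℕ.∸ m ℕ.* c)) ⟨
        fromℕ (m ℕ.* c ℕ.+ (M ℕ.* S ℕ.∸ m ℕ.* c)) - (fromℕ (m ℕ.* c) + fromℕ M * (fromℕ m * t))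
          ≡⟨ ≡.cong (λ n → fromℕ n - (fromℕ (m ℕ.* c) + fromℕ M * (fromℕ m * t))) mc+d ⟩
        fromℕ (M ℕ.* S) - (fromℕ (m ℕ.* c) + fromℕ M * (fromℕ m * t)) ∎) ,
      mc+d
      where
      open ≤-Reasoning
      S = ‖ Vec.map f r ‖₁
      key : fromℕ (m ℕ.* c) + fromℕ M * (fromℕ m * t) < fromℕ (M ℕ.* S)
      key = begin-strict
        fromℕ (m ℕ.* c) + fromℕ M * (fromℕ m * t)
          ≈⟨ +-congʳ (trans (fromℕ-* m c) (*-congˡ (sym Mp≈c))) ⟩
        fromℕ m * (fromℕ M * p) + fromℕ M * (fromℕ m * t)
          ≈⟨ solve 4 (λ m M p t → m :* (M :* p) :+ M :* (m :* t) := M :* m :* (p :+ t)) refl (fromℕ m) (fromℕ M) p t ⟩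
        fromℕ M * fromℕ m * (p + t)
          <⟨ *-monoˡ-< (*-pos ne (0<fromℕ m′)) p+t<S/m ⟩
        fromℕ M * fromℕ m * (fromℕ S / fromℕ m)
          ≈⟨ *-assoc _ _ _ ⟩
        fromℕ M * (fromℕ m * (fromℕ S / fromℕ m))
          ≈⟨ *-congˡ (*-/-cancel _ (0<fromℕ m′)) ⟩
        fromℕ M * fromℕ S
          ≈⟨ fromℕ-* M S ⟨
        fromℕ (M ℕ.* S) ∎
      mc≤MS : m ℕ.* c ℕ.≤ M ℕ.* S
      mc≤MS = fromℕ-cancel-≤ (≤-trans
        (≤-by (0≤* (0≤fromℕ M) (0≤* (0≤fromℕ m) 0≤t)) (solve 2 (λ a b → a :+ b :- a := b) refl (fromℕ (m ℕ.* c)) (fromℕ M * (fromℕ m * t))))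
        (inj₁ key))
      mc+d : m ℕ.* c ℕ.+ (M ℕ.* S ℕ.∸ m ℕ.* c) ≡ M ℕ.* S
      mc+d = ℕ.m+[n∸m]≡n mc≤MS

    0≤P : 0# ≤ P
    0≤P = ≤-average (tuples m xs) neᵐ (λ r → 0≤ind (does (exceeds? xs f m t r)))

    -- Integrality provides a slack: D is strictly larger than M m t.
    module _ (D : ℕ) (D-beyond : Beyond D) (D-least : ∀ d → Beyond d → D ℕ.≤ d) where

      -- Markov's inequality for z to the power M N S. On the event, M S = m c + d for some d beyond
      -- M m t, and d ≥ D by minimality, so the variable is at least zᴱ.
      markov : ∀ Q N → P * Base.z Q ^ (N ℕ.* (m ℕ.* c ℕ.+ D)) ≤ mgf (Base.z Q) p (M ℕ.* N) ^ m
      markov Q N = begin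
        P * z ^ E                                                        ≈⟨ average-*ʳ (tuples m xs) _ (z ^ E) ⟨
        average (tuples m xs) (λ r → ind (does (exceeds? xs f m t r)) * z ^ E) ≤⟨ average-mono (tuples m xs) neᵐ pointwise ⟩
        average (tuples m xs) (λ r → (z ^ (M ℕ.* N)) ^ ‖ Vec.map f r ‖₁) ≈⟨ average-tuples m xs ne f (z ^ (M ℕ.* N)) ⟩
        average xs (λ u → if f u then z ^ (M ℕ.* N) else 1#) ^ m         ≈⟨ ^-congˡ m (average-if (z ^ (M ℕ.* N))) ⟩
        mgf z p (M ℕ.* N) ^ m                                            ∎
        where
        open ≤-Reasoning
        open Base Q
        E = N ℕ.* (m ℕ.* c ℕ.+ D)
        pointwise : ∀ r → ind (does (exceeds? xs f m t r)) * z ^ E ≤ (z ^ (M ℕ.* N)) ^ ‖ Vec.map f r ‖₁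
        pointwise r = ind-does-*-≤ (exceeds? xs f m t r) (0≤^ S (0≤^ (M ℕ.* N) (inj₁ 0<z))) λ ex → bound (exceeds⇒beyond r ex)
          where
          S = ‖ Vec.map f r ‖₁
          bound : (∃ λ d → d ℕ.≤ M ℕ.* m × Beyond d × m ℕ.* c ℕ.+ d ≡ M ℕ.* S) → z ^ E ≤ (z ^ (M ℕ.* N)) ^ S
          bound (d , _ , beyond , mc+d≡MS) = begin
            z ^ E                                     ≤⟨ ^-monoʳ-≤ 1≤z (ℕ.*-monoʳ-≤ N (ℕ.+-monoʳ-≤ (m ℕ.* c) (D-least d beyond))) ⟩
            z ^ (N ℕ.* (m ℕ.* c ℕ.+ d))               ≡⟨ ≡.cong (λ k → z ^ (N ℕ.* k)) mc+d≡MS ⟩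
            z ^ (N ℕ.* (M ℕ.* S))                     ≡⟨ ≡.cong (z ^_) (≡.sym (ℕ.*-assoc N M S)) ⟩
            z ^ (N ℕ.* M ℕ.* S)                       ≡⟨ ≡.cong (λ k → z ^ (k ℕ.* S)) (ℕ.*-comm N M) ⟩
            z ^ (M ℕ.* N ℕ.* S)                       ≈⟨ ^-assocʳ z (M ℕ.* N) S ⟨
            (z ^ (M ℕ.* N)) ^ S                       ∎

      -- As l ≤ 2 m t², the left side is at most 2 (M m t)². The inequality is strict because D lies
      -- strictly beyond M m t, and this strictness is what `chernoff-exp` feeds on.
      exponent : fromℕ (m ℕ.* (M ℕ.* M)) * l < fromℕ (2 ℕ.* D ℕ.* D)
      exponent = begin-strict
        fromℕ (m ℕ.* (M ℕ.* M)) * l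
          ≤⟨ *-monoˡ-≤ (0≤fromℕ (m ℕ.* (M ℕ.* M))) l≤2mt² ⟩
        fromℕ (m ℕ.* (M ℕ.* M)) * (fromℕ 2 * fromℕ m * (t * t))
          ≈⟨ *-congʳ (trans (fromℕ-* m (M ℕ.* M)) (*-congˡ (fromℕ-* M M))) ⟩
        fromℕ m * (fromℕ M * fromℕ M) * (fromℕ 2 * fromℕ m * (t * t))
          ≈⟨ solve 3 (λ m M t → m :* (M :* M) :* (con (+ 2) :* m :* (t :* t)) := con (+ 2) :* ((M :* (m :* t)) :* (M :* (m :* t)))) refl (fromℕ m) (fromℕ M) t ⟩
        fromℕ 2 * (k * k)
          ≤⟨ *-monoˡ-≤ (0≤fromℕ 2) (*-monoˡ-≤ 0≤k (inj₁ D-beyond)) ⟩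
        fromℕ 2 * (k * fromℕ D)
          <⟨ *-monoˡ-< (0<fromℕ 1) (<-respˡ (*-comm _ _) (*-monoˡ-< (≤-<-trans 0≤k D-beyond) D-beyond)) ⟩
        fromℕ 2 * (fromℕ D * fromℕ D)
          ≈⟨ *-assoc _ _ _ ⟨
        fromℕ 2 * fromℕ D * fromℕ D
          ≈⟨ *-congʳ (fromℕ-* 2 D) ⟨
        fromℕ (2 ℕ.* D) * fromℕ D
          ≈⟨ fromℕ-* (2 ℕ.* D) D ⟨
        fromℕ (2 ℕ.* D ℕ.* D) ∎
        where
        open ≤-Reasoning
        k = fromℕ M * (fromℕ m * t)
        0≤k : 0# ≤ k
        0≤k = 0≤* (0≤fromℕ M) (0≤* (0≤fromℕ m) 0≤t)

      tail-at : ∀ n → expSum l n * P ≤ 1#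
      tail-at = chernoff-exp 0≤p p≤1 0≤P 0≤l m′ (length xs′) c D (proj₁ (proj₂ (total-ind xs f))) Mp≈c markov exponent

    tail : ∀ n → expSum l n * P ≤ 1#
    -- A deviating sample yields a number up to M m that lies beyond M m t. If the search up to M m
    -- finds none, the event is empty and `P` is at most 0.
    tail n with least-or-none {Beyond} (λ d → _ <? _) (M ℕ.* m)
    ... | inj₁ (D , D-beyond , D-least) = tail-at D D-beyond D-least n
    ... | inj₂ none = ≤-trans (*-monoˡ-≤ (0≤expSum n 0≤l) (average-≤ (tuples m xs) neᵐ never)) (≤-trans (inj₂ (zeroʳ _)) 0≤1)
      where
      never : ∀ r → ind (does (exceeds? xs f m t r)) ≤ 0#
      never r = ind-does-≤ (exceeds? xs f m t r) ≤-refl λ ex →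
        let d , d≤Mm , beyond , _ = exceeds⇒beyond r ex in contradiction beyond (none d d≤Mm)

  -- `tail` bounds each truncation of exp l times P. Passing to the limit E uses the bound 1/P on
  -- the truncations, whence the comparison of P with 0.
  hoeffding : ∀ (xs : List A) → Nonempty xs → ∀ f m {t l E} → 0# < fromℕ m → 0# ≤ t → 0# ≤ l →
              l ≤ fromℕ 2 * fromℕ m * (t * t) → IsExp l E →
              E * Pr (tuples m xs) (exceeds? xs f m t) ≤ 1#
  hoeffding []        ne _ _    _   _   _   _      _     = contradiction ne (<-irrefl refl)
  hoeffding (x ∷ xs)  ne f zero 0<m _   _   _      _     = contradiction 0<m (<-irrefl refl)
  hoeffding (x ∷ xs)  ne f (suc m) {t} {l} {E} 0<m 0≤t 0≤l l≤2mt² exp with compare 0# P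
    where open Hoeffding x xs f m 0≤t 0≤l l≤2mt²
  ... | tri≈ _ 0≈P _ = ≤-trans (inj₂ (trans (*-congˡ (sym 0≈P)) (zeroʳ E))) 0≤1
  ... | tri> _ _ P<0 = contradiction P<0 (≤⇒≯ (Hoeffding.0≤P x xs f m 0≤t 0≤l l≤2mt²))
  ... | tri< 0<P _ _ = ≤-trans (*-monoʳ-≤ (inj₁ 0<P) E≤) (inj₂ (trans (*-comm _ _) (*-/-cancel 1# 0<P)))
    where
    open Hoeffding x xs f m 0≤t 0≤l l≤2mt²
    open Exponential ℝ
    E≤ : E ≤ 1# / P
    E≤ = converges-≤ exp λ N → N , ℕ.≤-refl , ≤-/ 0<P (≤-trans
      (inj₂ (trans (*-congˡ (sum≈Σ< (expTerm l) N)) (*-comm _ _))) (tail N))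

-- Simulation of the subprotocol within an execution.

dropClaim-embed : {P V : Set} (t : Transcript P V) → dropClaim (List.map embed t) ≡ t
dropClaim-embed = List.mapMaybe-map-retract λ where
  (inj₁ p) → ≡.refl
  (inj₂ v) → ≡.refl

claim?-toℕ : ∀ {m} (W : Fin (suc m)) → claim? m (+ toℕ W) ≡ just W
claim?-toℕ {m} W with toℕ W ℕ.<? suc m
... | yes W<1+m = ≡.cong just (Fin.fromℕ<-toℕ W W<1+m)
... | no  W≮1+m = contradiction (Fin.toℕ<n W) W≮1+m

-- The prover of the subprotocol extracted from a prover of the execution; a
-- message of the wrong kind makes the execution reject, so p₀ may replace it.
extract : {P V : Set} → P → Strategy (ℤ ⊎ P) V → ℤ → Strategy P V
extract p₀ s w t = Sum.[ (λ _ → p₀) , (λ p → p) ] (s (inj₁ (inj₁ w) ∷ List.map embed t))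

module _ {Q Q′ P V : Set} {φ : Q → Q′} {O : Q′ → Bool} {O′ : Q → Bool} (O≗O′ : ∀ q → O (φ q) ≡ O′ q) where

  -- Throughout the run, the transcript is the claim followed by the embedded transcript of the
  -- subprotocol. From it `announce` recovers, through `dropClaim`, exactly what `s` would see.
  run-simulate : ∀ (π : Program Q P V) (s : Strategy P V) w t →
    run (simulate φ π) O (announce w s) (inj₁ (inj₁ w) ∷ List.map embed t) ≡
    map₂ (λ t → inj₁ (inj₁ w) ∷ List.map embed t) (run π O′ s t)
  run-simulate (output b)  s w t = ≡.refl
  run-simulate (query q κ) s w t rewrite O≗O′ q = run-simulate (κ (O′ q)) s w t
  run-simulate (send v π)  s w t rewrite ≡.sym (List.map-++ (embed {P} {V}) t (inj₂ v ∷ [])) =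
    run-simulate π s w (t ∷ʳ inj₂ v)
  run-simulate (receive κ) s w t rewrite dropClaim-embed t | ≡.sym (List.map-++ embed t (inj₁ (s t) ∷ [])) =
    run-simulate (κ (s t)) s w (t ∷ʳ inj₁ (s t))

  -- Only an implication: after a message of the wrong kind the execution rejects, whereas the
  -- extracted prover sends p₀ and may still be accepted.
  simulate-accepts : ∀ (p₀ : P) (π : Program Q P V) (s : Strategy (ℤ ⊎ P) V) w t →
    proj₁ (run (simulate φ π) O s (inj₁ (inj₁ w) ∷ List.map embed t)) ≡ true →
    proj₁ (run π O′ (extract p₀ s w) t) ≡ true
  simulate-accepts p₀ (output b)  s w t acc = acc
  simulate-accepts p₀ (query q κ) s w t acc rewrite O≗O′ q = simulate-accepts p₀ (κ (O′ q)) s w t acc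
  simulate-accepts p₀ (send v π)  s w t acc rewrite ≡.sym (List.map-++ embed t (inj₂ v ∷ [])) =
    simulate-accepts p₀ π s w (t ∷ʳ inj₂ v) acc
  simulate-accepts p₀ (receive κ) s w t acc with s (inj₁ (inj₁ w) ∷ List.map embed t) in eq
  -- A second claim would lead to `output false`, which `acc` refutes; hence the single case.
  ... | inj₂ p rewrite ≡.sym (List.map-++ embed t (inj₁ p ∷ [])) =
    simulate-accepts p₀ (κ p) s w (t ∷ʳ inj₁ p) acc

toℕ-weight : ∀ {m} (Y : Vec Bool m) → toℕ (weight Y) ≡ ‖ Y ‖₁
toℕ-weight Y = Fin.toℕ-fromℕ< (ℕ.s≤s (‖‖₁-bound Y))

-- Completeness and soundness of an execution.

module ErrorBounds (ℝ : RealNumbers) where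
  open Reals ℝ
  open OverReals ℝ
  open Averages ℝ

  ∣∣≤ : ∀ {x y} → x ≤ y → - x ≤ y → ∣ x ∣ ≤ y
  ∣∣≤ {x} {y} = ∣∣-elim (_≤ y) x

  <∣∣ : ∀ {x y} → y < ∣ x ∣ → y < x ⊎ y < - x
  <∣∣ {x} {y} = ∣∣-elim (λ z → y < z → y < x ⊎ y < - x) x inj₁ inj₂

  <∣∣ˡ : ∀ {x y} → y < x → y < ∣ x ∣
  <∣∣ˡ {x} y<x = <-≤-trans y<x (x≤∣x∣ x)

  <∣∣ʳ : ∀ {x y} → y < - x → y < ∣ x ∣
  <∣∣ʳ {x} y<-x = <-≤-trans y<-x (-x≤∣x∣ x)

  ind-≟true : ∀ b → ind (does (b Bool.≟ true)) ≈ ind b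
  ind-≟true true  = refl
  ind-≟true false = refl

  ind-≟false : ∀ b → ind (does (b Bool.≟ false)) ≈ 1# - ind (does (b Bool.≟ true))
  ind-≟false true  = sym (-‿inverseʳ 1#)
  ind-≟false false = solve 0 (con (+ 1) := con (+ 1) :- con (+ 0)) refl

  -- As `bitstrings 0` consists of `[]` alone, this erases the coins of a deterministic prover.
  average-×-[] : ∀ {A B : Set} (xs : List A) (y : B) (h : A × B → Carrier) →
                 average (cartesianProduct xs (y ∷ [])) h ≈ average xs (λ x → h (x , y))
  average-×-[] xs y h = *-cong
    (trans (total-cartesianProductWith _,_ xs (y ∷ []) h) (total-cong xs (λ x → +-identityʳ _)))
    (⁻¹-cong (trans (length-cartesianProductWith _,_ xs (y ∷ [])) (trans (*-congˡ fromℕ-1) (*-identityʳ _))))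

  sum-mono : ∀ {n} {h k : Fin n → Carrier} → (∀ i → h i ≤ k i) → sum h ≤ sum k
  sum-mono {zero}  h≤k = ≤-refl
  sum-mono {suc n} h≤k = +-mono-≤ (h≤k zero) (sum-mono (λ i → h≤k (suc i)))

  sum-const : ∀ n c → sum {n} (λ _ → c) ≈ fromℕ n * c
  sum-const zero    c = sym (zeroˡ c)
  sum-const (suc n) c = trans (+-congˡ (sum-const n c))
    (solve 2 (λ n c → c :+ n :* c := (con (+ 1) :+ n) :* c) refl (fromℕ n) c)

  -- Each summand has a share c/n of the bound; the multiplied form also makes sense for the empty
  -- sum.
  sum-≤ : ∀ n {h : Fin n → Carrier} {c} → 0# ≤ c → (∀ i → fromℕ n * h i ≤ c) → sum h ≤ c
  sum-≤ zero    0≤c _ = 0≤c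
  sum-≤ (suc n) {c = c} 0≤c nh≤c = ≤-trans (sum-mono (λ i → ≤-/ (0<fromℕ n) (nh≤c i)))
    (inj₂ (trans (sum-const (suc n) _) (*-/-cancel c (0<fromℕ n))))

  0≤sum : ∀ {n} {h : Fin n → Carrier} → (∀ i → 0# ≤ h i) → 0# ≤ sum h
  0≤sum {zero}  0≤h = ≤-refl
  0≤sum {suc n} 0≤h = 0≤+ (0≤h zero) (0≤sum (λ i → 0≤h (suc i)))

  ≤-sum : ∀ {n} {h : Fin n → Carrier} → (∀ i → 0# ≤ h i) → ∀ i → h i ≤ sum h
  ≤-sum {suc n} {h} 0≤h zero    = ≤-by (0≤sum (λ i → 0≤h (suc i)))
    (solve 2 (λ x y → x :+ y :- x := y) refl (h zero) _)
  ≤-sum {suc n} {h} 0≤h (suc i) = ≤-trans (≤-sum (λ i → 0≤h (suc i)) i)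
    (≤-by (0≤h zero) (solve 2 (λ x y → x :+ y :- y := x) refl (h zero) _))

  average-sum : ∀ {A : Set} (xs : List A) → Nonempty xs → ∀ n (h : A → Fin n → Carrier) →
                average xs (λ x → sum (h x)) ≈ sum (λ i → average xs (λ x → h x i))
  average-sum xs ne zero    h = average-const xs ne 0#
  average-sum xs ne (suc n) h = trans (average-+ xs _ _) (+-congˡ (average-sum xs ne n (λ x i → h x (suc i))))

  -- Splits a conditional error bound: δ on the good event, and the trivial bound 1 off it.
  -- Averaging over the sample then gives the unconditional bound.
  ≤-ind+ : ∀ {X : Set} (d : Dec X) {v δ} → v ≤ 1# → 0# ≤ δ → (X → v ≤ δ) → v ≤ ind (does (¬? d)) + δ
  ≤-ind+ (yes x) v≤1 0≤δ v≤δ = ≤-trans (v≤δ x) (inj₂ (sym (+-identityˡ _)))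
  ≤-ind+ (no  _) v≤1 0≤δ v≤δ = ≤-trans v≤1 (≤-by 0≤δ (solve 1 (λ δ → con (+ 1) :+ δ :- con (+ 1) := δ) refl _))

  g/2≈ : ∀ g → g / fromℕ 2 ≈ g / fromℕ 4 + g / fromℕ 4
  g/2≈ g = *-cancelˡ-≈ (0<fromℕ 1) (trans (*-/-cancel g (0<fromℕ 1)) (trans (sym (*-/-cancel g (0<fromℕ 3)))
    (solve 1 (λ t → con (+ 4) :* t := con (+ 2) :* (t :+ t)) refl (g / fromℕ 4))))

  g≈4t : ∀ g → g ≈ fromℕ 4 * (g / fromℕ 4)
  g≈4t g = sym (*-/-cancel g (0<fromℕ 3))

  module InSetting
    (εc εf : Carrier) (εc<εf : εc < εf) {X : Set} {k : ℕ} (f : Fin k → X → Bool)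
    {R : ℕ} (G : Vec Bool R → X) (D : Distribution X) (m : ℕ) where
    open Setting εc εf f G D m

    t : Carrier
    t = g / fromℕ 4

    0<g : 0# < g
    0<g = <⇒0<- εc<εf

    0≤t : 0# ≤ t
    0≤t = 0≤/ (inj₁ 0<g) (0<fromℕ 3)

    nonempty-samples : Nonempty (samples R m)
    nonempty-samples = nonempty-tuples m (bitstrings R) (nonempty-bitstrings R)

    -- The triangle inequality through μ gives εc + g/4, which leaves g/4 to spare.
    consistent-honest : ∀ {w μ σ} → ∣ w - μ ∣ ≤ t → ∣ μ - σ ∣ ≤ εc → ∣ w - σ ∣ ≤ εc + g / fromℕ 2
    consistent-honest {w} {μ} {σ} w-μ μ-σ = ∣∣≤
      (≤-trans (≤-by (0≤+ (≤⇒0≤- (≤-trans (x≤∣x∣ (w - μ)) w-μ)) (0≤+ (≤⇒0≤- (≤-trans (x≤∣x∣ (μ - σ)) μ-σ)) 0≤t))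
        (solve 5 (λ w μ σ t ε → ε :+ (t :+ t) :- (w :- σ) := (t :- (w :- μ)) :+ ((ε :- (μ :- σ)) :+ t)) refl w μ σ t εc)) rhs)
      (≤-trans (≤-by (0≤+ (≤⇒0≤- (≤-trans (-x≤∣x∣ (w - μ)) w-μ)) (0≤+ (≤⇒0≤- (≤-trans (-x≤∣x∣ (μ - σ)) μ-σ)) 0≤t))
        (solve 5 (λ w μ σ t ε → ε :+ (t :+ t) :- (:- (w :- σ)) := (t :- (:- (w :- μ))) :+ ((ε :- (:- (μ :- σ))) :+ t)) refl w μ σ t εc)) rhs)
      where
      rhs : εc + (t + t) ≤ εc + g / fromℕ 2
      rhs = inj₂ (+-congˡ (sym (g/2≈ g)))

    -- The triangle inequality from μ to σ through y and w: the distance of y and w exceeds εf - g/4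
    -- - (εc + g/2), which is g/4. This is exactly the proximity parameter of the subprotocol.
    far-from-claim : ∀ {y w μ σ} → ∣ y - μ ∣ ≤ t → ∣ w - σ ∣ ≤ εc + g / fromℕ 2 → εf < ∣ μ - σ ∣ → t < ∣ y - w ∣
    far-from-claim {y} {w} {μ} {σ} y-μ w-σ εf< = Sum.[ above , below ] (<∣∣ εf<)
      where
      w-σ′ : ∣ w - σ ∣ ≤ εc + (t + t)
      w-σ′ = ≤-trans w-σ (inj₂ (+-congˡ (g/2≈ g)))
      -- The ring solver treats t as an independent variable, so its identities leave a remainder g
      -- - 4 t, which is zero.
      drop-g-4t : ∀ x → x + (g - fromℕ 4 * t) ≈ x
      drop-g-4t x = trans (+-congˡ (trans (+-congʳ (g≈4t g)) (-‿inverseʳ _))) (+-identityʳ x)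
      above : εf < μ - σ → t < ∣ y - w ∣
      above εf<μ-σ = <∣∣ˡ (<-by
        (0<+ (<⇒0<- εf<μ-σ) (0≤+ (≤⇒0≤- (≤-trans (-x≤∣x∣ (y - μ)) y-μ)) (≤⇒0≤- (≤-trans (x≤∣x∣ (w - σ)) w-σ′))))
        (trans (solve 7 (λ y w μ σ t εc εf → y :- w :- t :=
            ((μ :- σ :- εf) :+ ((t :- :- (y :- μ)) :+ (εc :+ (t :+ t) :- (w :- σ)))) :+ (εf :- εc :- con (+ 4) :* t))
            refl y w μ σ t εc εf)
          (drop-g-4t _)))
      below : εf < - (μ - σ) → t < ∣ y - w ∣
      below εf<σ-μ = <∣∣ʳ (<-by
        (0<+ (<⇒0<- εf<σ-μ) (0≤+ (≤⇒0≤- (≤-trans (x≤∣x∣ (y - μ)) y-μ)) (≤⇒0≤- (≤-trans (-x≤∣x∣ (w - σ)) w-σ′))))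
        (trans (solve 7 (λ y w μ σ t εc εf → :- (y :- w) :- t :=
            ((:- (μ :- σ) :- εf) :+ ((t :- (y :- μ)) :+ (εc :+ (t :+ t) :- (:- (w :- σ))))) :+ (εf :- εc :- con (+ 4) :* t))
            refl y w μ σ t εc εf)
          (drop-g-4t _)))

    module _ (π : WeightProtocol m) where
      open WeightProtocol π
      open Execution π

      nonempty-coins : ∀ (n : ℕ) → Nonempty (cartesianProduct (bitstrings coins) (bitstrings n))
      nonempty-coins n = nonempty-× (bitstrings coins) (bitstrings n) (nonempty-bitstrings coins) (nonempty-bitstrings n)

      runs-on-sample : ∀ r a σ → RunsOnSample r a σ
      runs-on-sample r a σ W ρ s consistent
        rewrite claim?-toℕ W | dec-true (consistent? σ W) consistent =
        run-simulate (λ i → ≡.sym (Vec.lookup-map i (λ u → f a (G u)) r)) (program W ρ) s (+ toℕ W) []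

      outputProb≤1 : ∀ {Q P V : Set} b (v : Verifier Q P V) O p → outputProb b v O p ≤ 1#
      outputProb≤1 b v O p = average-≤ (cartesianProduct (bitstrings (Verifier.coins v)) (bitstrings (Prover.coins p)))
        (nonempty-× (bitstrings (Verifier.coins v)) (bitstrings (Prover.coins p)) (nonempty-bitstrings (Verifier.coins v)) (nonempty-bitstrings (Prover.coins p)))
        (λ x → ind≤1 _)

      module _ {δ : Carrier} (complete : CompletenessError≤ π δ) (sound : SoundnessError≤ π t δ) where

        -- Completeness on any one string, here the zero string, places 1 - δ below a probability,
        -- hence below 1.
        0≤δ : 0# ≤ δ
        0≤δ = ≤-by (≤⇒0≤- (≤-trans (complete Y₀ (weight Y₀) (≡.sym (toℕ-weight Y₀)))
                     (outputProb≤1 true (verifier (weight Y₀)) (lookup Y₀) (honest Y₀ (weight Y₀)))))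
          (solve 1 (λ δ → δ :- con (+ 0) := con (+ 1) :- (con (+ 1) :- δ)) refl δ)
          where Y₀ = Vec.replicate m false

        module _ (r : Sample) (good : Good r) (a : Fin k) (σ : Carrier) where
          private Y = Y[ a ] r

          completeness : ∣ μ a - σ ∣ ≤ εc → rejectHonestProb r a σ ≤ δ
          completeness μ-σ = begin
            rejectHonestProb r a σ
              ≈⟨ average-cong coinList (λ (ρ , ρ′) → trans (reflexive (≡.cong (λ b → ind (does (b Bool.≟ false))) (same-output ρ ρ′))) (ind-≟false (out ρ ρ′))) ⟩
            average coinList (λ (ρ , ρ′) → 1# - ind (does (out ρ ρ′ Bool.≟ true)))
              ≈⟨ average-cong coinList (λ _ → +-congˡ (solve 1 (λ x → :- x := x :* :- con (+ 1)) refl _)) ⟩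
            average coinList (λ (ρ , ρ′) → 1# + ind (does (out ρ ρ′ Bool.≟ true)) * - 1#)
              ≈⟨ trans (average-+ coinList _ _) (+-cong (average-const coinList (nonempty-coins _) 1#) (average-*ʳ coinList _ (- 1#))) ⟩
            1# + acceptProb (verifier W) (lookup Y) p * - 1#
              ≤⟨ ≤-by (≤⇒0≤- (complete Y W (≡.sym (toℕ-weight Y))))
                   (solve 2 (λ δ A → δ :- (con (+ 1) :+ A :* :- con (+ 1)) := A :- (con (+ 1) :- δ)) refl δ (acceptProb (verifier W) (lookup Y) p)) ⟩
            δ ∎
            where
            open ≤-Reasoning
            W = weight Y
            p = honest Y W
            coinList = cartesianProduct (bitstrings coins) (bitstrings (Prover.coins p))
            out : Vec Bool coins → Vec Bool (Prover.coins p) → Bool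
            out ρ ρ′ = proj₁ (run (program W ρ) (lookup Y) (Prover.strategy p ρ′) [])
            consistent : Consistent σ W
            consistent = consistent-honest
              (≡.subst (λ n → ∣ fromℕ n / fromℕ m - μ a ∣ ≤ t) (≡.sym (toℕ-weight Y)) (good a)) μ-σ
            same-output : ∀ ρ ρ′ → proj₁ (run (Verifier.program (execVerifier r a σ) ρ) oracle
                            (Prover.strategy (honestExec r a σ) ρ′) []) ≡ out ρ ρ′
            same-output ρ ρ′ = ≡.trans
              (≡.cong (λ n → proj₁ (run (Verifier.program (execVerifier r a σ) ρ) oracle (announce (+ n) (Prover.strategy p ρ′)) [])) (≡.sym (toℕ-weight Y)))
              (≡.cong proj₁ (runs-on-sample r a σ W ρ (Prover.strategy p ρ′) consistent))

          -- `extract` needs some message of the right type; the honest prover's reply to the empty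
          -- transcript provides one.
          defaultMsg : PMsg
          defaultMsg = Prover.strategy (honest Y (weight Y)) (Vec.replicate _ false) []

          module _ (far : εf < ∣ μ a - σ ∣) (s : Strategy (ℤ ⊎ PMsg) VMsg) where

            Accepts≤ : (Vec Bool coins → Program (Fin k × X) (ℤ ⊎ PMsg) VMsg) → Transcript (ℤ ⊎ PMsg) VMsg → Set
            Accepts≤ prog tr = average (bitstrings coins)
              (λ ρ → ind (does (proj₁ (run (prog ρ) oracle s tr) Bool.≟ true))) ≤ δ

            rejecting : ∀ tr → Accepts≤ (λ _ → output false) tr
            rejecting tr = ≤-trans (inj₂ (average-const (bitstrings coins) (nonempty-bitstrings coins) 0#)) 0≤δ

            after-check : ∀ w W (d : Dec (Consistent σ W)) →
              Accepts≤ (λ ρ → if does d then simulate (position r a σ) (program W ρ) else output false)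
                       (inj₁ (inj₁ w) ∷ [])
            after-check w W (no _) = rejecting (inj₁ (inj₁ w) ∷ [])
            after-check w W (yes consistent) = ≤-trans
              (average-mono (bitstrings coins) (nonempty-bitstrings coins) (λ ρ → ind-mono (simulate-accepts {O′ = lookup Y} lookup-Y defaultMsg (program W ρ) s w [])))
              (≤-trans (inj₂ (sym (average-×-[] (bitstrings coins) [] _)))
                -- The prover's coins are already fixed in `s`, so the extracted prover tosses none.
                (sound Y W (record { coins = 0 ; strategy = λ _ → extract defaultMsg s w })
                  (far-from-claim (good a) consistent far)))
              where
              lookup-Y : ∀ i → oracle (position r a σ i) ≡ lookup Y i
              lookup-Y i = ≡.sym (Vec.lookup-map i (λ u → f a (G u)) r)
              ind-mono : ∀ {b b′} → (b ≡ true → b′ ≡ true) → ind (does (b Bool.≟ true)) ≤ ind (does (b′ Bool.≟ true))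
              ind-mono {false}         _    = 0≤ind _
              ind-mono {true}  {true}  _    = ≤-refl
              ind-mono {true}  {false} b⇒b′ with b⇒b′ ≡.refl
              ... | ()

            after-claim : ∀ w W? → Accepts≤ (λ ρ → afterClaim r a σ ρ W?) (inj₁ (inj₁ w) ∷ [])
            after-claim w nothing  = rejecting (inj₁ (inj₁ w) ∷ [])
            after-claim w (just W) = after-check w W (consistent? σ W)

            -- With its coins fixed, the prover sends the same first message whatever the verifier's
            -- coins are. Hence one claim W serves the whole average over ρ, and soundness for that
            -- W applies.
            after-start : ∀ msg → Accepts≤ (λ ρ → start r a σ ρ msg) (inj₁ msg ∷ [])
            after-start (inj₁ w) = after-claim w (claim? m w)
            after-start (inj₂ p) = rejecting (inj₁ (inj₂ p) ∷ [])

          soundness : εf < ∣ μ a - σ ∣ → (p : ExecProver r a σ) → acceptProverProb r a σ p ≤ δ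
          soundness far p = average-×-≤ (bitstrings coins) (bitstrings (Prover.coins p))
            (nonempty-bitstrings coins) (nonempty-bitstrings (Prover.coins p))
            (λ ρ′ → after-start far (Prover.strategy p ρ′) (Prover.strategy p ρ′ []))

        average-error : ∀ {δsamp} (v : Sample → Carrier) → Pr (samples R m) (λ r → ¬? (good? r)) ≤ δsamp →
                        (∀ r → v r ≤ 1#) → (∀ r → Good r → v r ≤ δ) → average (samples R m) v ≤ δsamp + δ
        average-error {δsamp} v bad≤ v≤1 v≤δ = begin
          average (samples R m) v
            ≤⟨ average-mono (samples R m) nonempty-samples (λ r → ≤-ind+ (good? r) (v≤1 r) 0≤δ (v≤δ r)) ⟩
          average (samples R m) (λ r → ind (does (¬? (good? r))) + δ)
            ≈⟨ trans (average-+ (samples R m) _ _) (+-congˡ (average-const (samples R m) nonempty-samples δ)) ⟩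
          Pr (samples R m) (λ r → ¬? (good? r)) + δ
            ≤⟨ +-mono-≤ bad≤ ≤-refl ⟩
          δsamp + δ ∎
          where open ≤-Reasoning

-- Concentration of all k sample weights.

‖not‖ : ∀ {A : Set} {m} (f : A → Bool) (r : Vec A m) → ‖ Vec.map (not ∘ f) r ‖₁ ℕ.+ ‖ Vec.map f r ‖₁ ≡ m
‖not‖ f []      = ≡.refl
‖not‖ f (u ∷ r) with f u
... | true  = ≡.trans (ℕ.+-suc _ _) (≡.cong suc (‖not‖ f r))
... | false = ≡.cong suc (‖not‖ f r)

module Sampling (ℝ : RealNumbers) where
  open Reals ℝ
  open OverReals ℝ
  open Averages ℝ
  open Bonferroni ℝ using (exp-nonpositive)
  open ErrorBounds ℝ

  fromℤ-≤-fromℕ : ∀ {c m} → c ℤ.≤ + m → fromℤ c ≤ fromℕ m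
  fromℤ-≤-fromℕ {+ n}      (ℤ.+≤+ n≤m) = fromℕ-mono-≤ n≤m
  fromℤ-≤-fromℕ { -[1+ n ]} {m} _      = ≤-trans
    (≤-by (0≤fromℕ (suc n)) (solve 1 (λ x → con (+ 0) :- (:- x) := x) refl (fromℕ (suc n)))) (0≤fromℕ m)

  module _
    (εc εf δ : Carrier) (εc<εf : εc < εf) {X : Set} {R : ℕ} (G : Vec Bool R → X) (D : Distribution X)
    (hasLaw : HasLaw G D) {k : ℕ} (f : Fin k → X → Bool) (m : ℕ) (0<δ : 0# < δ) (δ<1 : δ < 1#)
    {l : Carrier} (isLn : IsLn (fromℕ (2 ℕ.* k) / δ) l) where
    open Setting εc εf f G D m
    open InSetting εc εf εc<εf f G D m using (t; 0<g; 0≤t; nonempty-samples)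

    module _ (a : Fin k) {c : ℤ} (isCeiling : IsCeiling ((fromℕ 8 * l) / (g ^ 2)) c) (c≤m : c ℤ.≤ + m) where

      1≤2k : fromℕ 1 ≤ fromℕ (2 ℕ.* k)
      -- The index `a` witnesses that k is at least 1.
      1≤2k = fromℕ-mono-≤ (ℕ.≤-trans (ℕ.≤-trans (ℕ.s≤s ℕ.z≤n) (Fin.toℕ<n a)) (ℕ.m≤m+n k _))

      0<l : 0# < l
      0<l = ≰⇒> λ l≤0 → <-irrefl refl (begin-strict
        δ                                ≈⟨ *-identityʳ δ ⟨
        δ * 1#                           <⟨ *-monoˡ-< 0<δ (<-≤-trans 1<E (exp-nonpositive l≤0 isLn)) ⟩
        δ * 1#                           ≈⟨ *-identityʳ δ ⟩
        δ                                ∎)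
        where
        open ≤-Reasoning
        1<E : 1# < fromℕ (2 ℕ.* k) / δ
        1<E = *-cancelˡ-< (inj₁ 0<δ) (begin-strict
          δ * 1#                         ≈⟨ *-identityʳ δ ⟩
          δ                              <⟨ δ<1 ⟩
          1#                             ≈⟨ fromℕ-1 ⟨
          fromℕ 1                        ≤⟨ 1≤2k ⟩
          fromℕ (2 ℕ.* k)                ≈⟨ *-/-cancel _ 0<δ ⟨
          δ * (fromℕ (2 ℕ.* k) / δ)      ∎)

      0<g² : 0# < g ^ 2
      0<g² = 0<^ 2 0<g

      8l/g²≤m : (fromℕ 8 * l) / (g ^ 2) ≤ fromℕ m
      8l/g²≤m = ≤-trans (proj₂ isCeiling) (fromℤ-≤-fromℕ c≤m)

      0<m : 0# < fromℕ m
      0<m = <-≤-trans (*-pos (*-pos (0<fromℕ 7) 0<l) (0<⁻¹ 0<g²)) 8l/g²≤m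

      -- The constant 8 in the sample size enters here: g = 4 t, so 8 l ≤ g² m = 16 t² m.
      l≤2mt² : l ≤ fromℕ 2 * fromℕ m * (t * t)
      l≤2mt² = *-cancelˡ-≤ (0<fromℕ 7) (begin
        fromℕ 8 * l                                     ≈⟨ *-/-cancel _ 0<g² ⟨
        g ^ 2 * ((fromℕ 8 * l) / (g ^ 2))               ≤⟨ *-monoˡ-≤ (inj₁ 0<g²) 8l/g²≤m ⟩
        g ^ 2 * fromℕ m                                 ≈⟨ *-congʳ (^-congˡ 2 (g≈4t g)) ⟩
        (fromℕ 4 * t) ^ 2 * fromℕ m
          ≈⟨ solve 2 (λ t m → con (+ 4) :* t :* (con (+ 4) :* t :* con (+ 1)) :* m := con (+ 8) :* (con (+ 2) :* m :* (t :* t))) refl t (fromℕ m) ⟩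
        fromℕ 8 * (fromℕ 2 * fromℕ m * (t * t))         ∎)
        where open ≤-Reasoning

      -- Since exp l = 2k/δ, multiplying `hoeffding` by δ bounds 2k times the tail probability.
      tail-bound : ∀ h → fromℕ (2 ℕ.* k) * Pr (samples R m) (exceeds? (bitstrings R) h m t) ≤ δ
      tail-bound h = begin
        fromℕ (2 ℕ.* k) * P                 ≈⟨ *-congʳ (*-/-cancel _ 0<δ) ⟨
        δ * (fromℕ (2 ℕ.* k) / δ) * P       ≈⟨ *-assoc _ _ _ ⟩
        δ * (fromℕ (2 ℕ.* k) / δ * P)
          ≤⟨ *-monoˡ-≤ (inj₁ 0<δ) (hoeffding (bitstrings R) (nonempty-bitstrings R) h m 0<m 0≤t (inj₁ 0<l) l≤2mt² isLn) ⟩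
        δ * 1#                              ≈⟨ *-identityʳ δ ⟩
        δ                                   ∎
        where
        open ≤-Reasoning
        P = Pr (samples R m) (exceeds? (bitstrings R) h m t)

      h h̄ : Vec Bool R → Bool
      h u = f a (G u)
      h̄ u = not (h u)

      mean≈μ : average (bitstrings R) (ind ∘ h) ≈ μ a
      mean≈μ = trans (average-cong (bitstrings R) (λ u → sym (ind-≟true (h u)))) (sym (hasLaw (f a)))

      mean-not≈ : average (bitstrings R) (ind ∘ h̄) ≈ 1# - μ a
      mean-not≈ = begin-equality
        average (bitstrings R) (ind ∘ h̄)
          ≈⟨ average-cong (bitstrings R) (λ u → ind-not (h u)) ⟩
        average (bitstrings R) (λ u → 1# + ind (h u) * - 1#)
          ≈⟨ average-+ (bitstrings R) (λ _ → 1#) (λ u → ind (h u) * - 1#) ⟩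
        average (bitstrings R) (λ _ → 1#) + average (bitstrings R) (λ u → ind (h u) * - 1#)
          ≈⟨ +-cong (average-const (bitstrings R) (nonempty-bitstrings R) 1#) (average-*ʳ (bitstrings R) (ind ∘ h) (- 1#)) ⟩
        1# + average (bitstrings R) (ind ∘ h) * - 1#
          ≈⟨ +-congˡ (*-congʳ mean≈μ) ⟩
        1# + μ a * - 1#
          ≈⟨ solve 1 (λ x → con (+ 1) :+ x :* :- con (+ 1) := con (+ 1) :- x) refl (μ a) ⟩
        1# - μ a ∎
        where
        open ≤-Reasoning
        ind-not : ∀ b → ind (not b) ≈ 1# + ind b * - 1#
        ind-not true  = solve 0 (con (+ 0) := con (+ 1) :+ con (+ 1) :* :- con (+ 1)) refl
        ind-not false = solve 0 (con (+ 1) := con (+ 1) :+ con (+ 0) :* :- con (+ 1)) refl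

      -- The lower tail of `h` is the upper tail of its negation `h̄`, which has mean 1 - μ and, by
      -- `‖not‖`, weight m minus that of `h`. One-sided tails therefore suffice.
      deviates : ∀ r → ¬ (∣ fromℕ ‖ Y[ a ] r ‖₁ / fromℕ m - μ a ∣ ≤ t) →
                 Exceeds (bitstrings R) h m t r ⊎ Exceeds (bitstrings R) h̄ m t r
      deviates r ¬≤ = Sum.map
        (λ t< → begin-strict
          average (bitstrings R) (ind ∘ h) + t         ≈⟨ +-congʳ mean≈μ ⟩
          μ a + t                                      <⟨ <-by (<⇒0<- t<) (solve 3 (λ s μ t → s :- (μ :+ t) := s :- μ :- t) refl (S / fromℕ m) (μ a) t) ⟩
          S / fromℕ m                                  ∎)
        (λ t< → begin-strict
          average (bitstrings R) (ind ∘ h̄) + t         ≈⟨ +-congʳ mean-not≈ ⟩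
          1# - μ a + t                                 <⟨ <-by (<⇒0<- t<) (trans (+-congʳ S̄/m) (solve 3 (λ s μ t → con (+ 1) :- s :- (con (+ 1) :- μ :+ t) := :- (s :- μ) :- t) refl (S / fromℕ m) (μ a) t)) ⟩
          S̄ / fromℕ m                                  ∎)
        (<∣∣ (≰⇒> ¬≤))
        where
        open ≤-Reasoning
        S = fromℕ ‖ Vec.map h r ‖₁
        S̄ = fromℕ ‖ Vec.map h̄ r ‖₁
        S̄/m : S̄ / fromℕ m ≈ 1# - S / fromℕ m
        S̄/m = begin-equality
          S̄ * fromℕ m ⁻¹                       ≈⟨ solve 3 (λ s̄ s i → s̄ :* i := (s̄ :+ s) :* i :- s :* i) refl S̄ S (fromℕ m ⁻¹) ⟩
          (S̄ + S) * fromℕ m ⁻¹ - S / fromℕ m   ≈⟨ +-congʳ (*-congʳ (trans (sym (fromℕ-+ ‖ Vec.map h̄ r ‖₁ ‖ Vec.map h r ‖₁)) (reflexive (≡.cong fromℕ (‖not‖ h r))))) ⟩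
          fromℕ m * fromℕ m ⁻¹ - S / fromℕ m   ≈⟨ +-congʳ (*-⁻¹ 0<m) ⟩
          1# - S / fromℕ m                     ∎

    up down : Fin k → Sample → Carrier
    up a r = ind (does (exceeds? (bitstrings R) (λ u → f a (G u)) m t r))
    down a r = ind (does (exceeds? (bitstrings R) (λ u → not (f a (G u))) m t r))

    -- A union bound over the k functions and the two tails of each, every tail having probability
    -- at most δ/(2k).
    bad-probability : {c : ℤ} → IsCeiling ((fromℕ 8 * l) / (g ^ 2)) c → c ℤ.≤ + m →
                      Pr (samples R m) (λ r → ¬? (good? r)) ≤ δ
    bad-probability isCeiling c≤m = begin
      Pr (samples R m) (λ r → ¬? (good? r))
        ≤⟨ average-mono (samples R m) nonempty-samples union ⟩
      average (samples R m) (λ r → sum (λ a → up a r + down a r))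
        ≈⟨ average-sum (samples R m) nonempty-samples k (λ r a → up a r + down a r) ⟩
      sum (λ a → average (samples R m) (λ r → up a r + down a r))
        ≤⟨ sum-≤ k (inj₁ 0<δ) each ⟩
      δ ∎
      where
      open ≤-Reasoning
      0≤up+down : ∀ r a → 0# ≤ up a r + down a r
      0≤up+down r a = 0≤+ (0≤ind _) (0≤ind _)
      1≤ind-yes : ∀ {Z : Set} (d : Dec Z) → Z → 1# ≤ ind (does d)
      1≤ind-yes (yes _) _ = ≤-refl
      1≤ind-yes (no ¬z) z = contradiction z ¬z
      one : ∀ r a → Exceeds (bitstrings R) (λ u → f a (G u)) m t r ⊎ Exceeds (bitstrings R) (λ u → not (f a (G u))) m t r →
            1# ≤ up a r + down a r
      one r a (inj₁ ex) = ≤-trans (inj₂ (sym (+-identityʳ 1#))) (+-mono-≤ (1≤ind-yes (exceeds? (bitstrings R) (λ u → f a (G u)) m t r) ex) (0≤ind _))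
      one r a (inj₂ ex) = ≤-trans (inj₂ (sym (+-identityˡ 1#))) (+-mono-≤ (0≤ind _) (1≤ind-yes (exceeds? (bitstrings R) (λ u → not (f a (G u))) m t r) ex))
      union : ∀ r → ind (does (¬? (good? r))) ≤ sum (λ a → up a r + down a r)
      union r = ind-does-≤ (¬? (good? r)) (0≤sum (0≤up+down r)) λ ¬good →
        let a , ¬close = Fin.¬∀⟶∃¬ k _ (λ a → ∣ fromℕ ‖ Y[ a ] r ‖₁ / fromℕ m - μ a ∣ ≤? (g / fromℕ 4)) ¬good
        in ≤-trans (one r a (deviates a isCeiling c≤m r ¬close)) (≤-sum (0≤up+down r) a)
      each : ∀ a → fromℕ k * average (samples R m) (λ r → up a r + down a r) ≤ δ
      each a = *-cancelˡ-≤ (0<fromℕ 1) (begin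
        fromℕ 2 * (fromℕ k * average (samples R m) (λ r → up a r + down a r))
          ≈⟨ *-congˡ (*-congˡ (average-+ (samples R m) (up a) (down a))) ⟩
        fromℕ 2 * (fromℕ k * (average (samples R m) (up a) + average (samples R m) (down a)))
          ≈⟨ solve 3 (λ k x y → con (+ 2) :* (k :* (x :+ y)) := con (+ 2) :* k :* x :+ con (+ 2) :* k :* y) refl (fromℕ k) (average (samples R m) (up a)) (average (samples R m) (down a)) ⟩
        fromℕ 2 * fromℕ k * average (samples R m) (up a) + fromℕ 2 * fromℕ k * average (samples R m) (down a)
          ≈⟨ +-cong (*-congʳ (fromℕ-* 2 k)) (*-congʳ (fromℕ-* 2 k)) ⟨
        fromℕ (2 ℕ.* k) * average (samples R m) (up a) + fromℕ (2 ℕ.* k) * average (samples R m) (down a)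
          ≤⟨ +-mono-≤ (tail-bound a isCeiling c≤m _) (tail-bound a isCeiling c≤m _) ⟩
        δ + δ
          ≈⟨ solve 1 (λ δ → δ :+ δ := con (+ 2) :* δ) refl δ ⟩
        fromℕ 2 * δ ∎)

proposition4p12 : (ℝ : RealNumbers) →
    let open RealNumbers ℝ
        open OverReals ℝ
    in
    (εc εf δsamp : Carrier) → 0# ≤ εc → εc < εf → εf ≤ 1# →
    (X : Set) (R : ℕ) (G : Vec Bool R → X) (D : Distribution X) → HasLaw G D →
    (k : ℕ) (f : Fin k → X → Bool) (m : ℕ) →
    let open Setting εc εf f G D m in
    0# < δsamp → δsamp < 1# →
    (l : Carrier) → IsLn (fromℕ (2 ℕ.* k) / δsamp) l →
    (c : ℤ) → IsCeiling ((fromℕ 8 * l) / (g ^ 2)) c →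
    c ℤ.≤ + m →
    (Pr (samples R m) (λ r → ¬? (good? r)) ≤ δsamp)
    ×
    ((π : WeightProtocol m) →
      let open Execution π in
      ((r : Sample) → Good r → (a : Fin k) (σ : Carrier) → RunsOnSample r a σ)
      ×
      ((δipp : Carrier) → CompletenessError≤ π δipp → SoundnessError≤ π (g / fromℕ 4) δipp →
        ((r : Sample) → Good r → (a : Fin k) (σ : Carrier) →
          (∣ μ a - σ ∣ ≤ εc → rejectHonestProb r a σ ≤ δipp)
          ×
          (εf < ∣ μ a - σ ∣ → (p : ExecProver r a σ) → acceptProverProb r a σ p ≤ δipp))
        ×
        ((a : Fin k) (σ : Carrier) →
          (∣ μ a - σ ∣ ≤ εc →
            average (samples R m) (λ r → rejectHonestProb r a σ) ≤ δsamp + δipp)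
          ×
          (εf < ∣ μ a - σ ∣ → (p : (r : Sample) → ExecProver r a σ) →
            average (samples R m) (λ r → acceptProverProb r a σ (p r)) ≤ δsamp + δipp))))
proposition4p12 ℝ εc εf δsamp _ εc<εf _ X R G D hasLaw k f m 0<δ δ<1 l isLn c isCeiling c≤m =
  bad≤δ , λ π → (λ r _ → runs-on-sample π r) , λ δipp complete sound →
    (λ r good a σ → completeness π complete sound r good a σ , soundness π complete sound r good a σ) ,
    λ a σ →
      (λ close → average-error π complete sound (λ r → rejectHonestProb π r a σ) bad≤δ
        (λ r → outputProb≤1 π false (execVerifier π r a σ) oracle (honestExec π r a σ))
        (λ r good → completeness π complete sound r good a σ close)) ,
      (λ far p → average-error π complete sound (λ r → acceptProverProb π r a σ (p r)) bad≤δ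
        (λ r → outputProb≤1 π true (execVerifier π r a σ) oracle (p r))
        (λ r good → soundness π complete sound r good a σ far (p r)))
  where
  open ErrorBounds.InSetting ℝ εc εf εc<εf f G D m
  open OverReals.Setting ℝ εc εf f G D m
  open Execution
  bad≤δ = Sampling.bad-probability ℝ εc εf δsamp εc<εf G D hasLaw f m 0<δ δ<1 isLn isCeiling c≤m
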